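{- Let $H,V:\mathsf{CMS}\to\mathsf{CMS}$ be contracting endofunctors, let $e:V\to T(H+V)$ be a guarded recursive program scheme, and let $(A,a)$ be a non-empty $H$-algebra in $\mathsf{CMS}$. Then the unique interpreted solution $e^\ddagger_A:VA\to A$ of $e$ in $A$ is the unique fixed point of the function $R$ on $\mathsf{CMS}(VA,A)$ defined by $$R(f)=\Bigl(VA\xrightarrow{\ e_A\ }T(H+V)A\xrightarrow{\ \widetilde{[a,f]}\ }A\Bigr).$$
   Context: $\mathsf{CMS}$ is the category of complete metric spaces with distances in $[0,1]$ and non-expanding maps ($d_Y(fx,fx')\le d_X(x,x')$). Hom-sets carry the metric $d_{X,Y}(f,g)=\sup_{x}d_Y(fx,gx)$. An endofunctor $H$ is contracting if there is $\varepsilon<1$ with $d_{HX,HY}(Hf,Hg)\le\varepsilon\, d_{X,Y}(f,g)$ for all $X,Y$ and $f,g:X\to Y$. Contracting endofunctors are iteratable (defined below) and closed under finite coproducts (known facts). Coproduct injections are $\mathrm{inl},\mathrm{inr}$; identities are denoted by the name of the object. An endofunctor $H$ is iteratable if for every object $X$ the functor $H(\,\_\,)+X$ has a final coalgebra $\alpha^H_X:T(H)X\to H\,T(H)X+X$; it is an isomorphism with inverse $[\tau^H_X,\eta^H_X]$. $T(H)$ is a monad $(T(H),\eta^H,\mu^H)$: $T(H)f$ (for $f:X\to Y$) is the unique morphism with $T(H)f\cdot\tau^H_X=\tau^H_Y\cdot H\,T(H)f$ and $T(H)f\cdot\eta^H_X=\eta^H_Y\cdot f$; $\mu^H_X$ is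 the unique morphism with $\mu^H_X\cdot\tau^H_{T(H)X}=\tau^H_X\cdot H\mu^H_X$, $\mu^H_X\cdot\eta^H_{T(H)X}=\mathrm{id}$. Put $\kappa^H=\tau^H\cdot H\eta^H$. A recursive program scheme is a natural transformation $e:V\to T(H+V)$; it is guarded if $e=\tau^{H+V}\cdot(\mathrm{inl}\,T(H+V))\cdot f$ for some natural transformation $f:V\to H\,T(H+V)$. For guarded $e$ there is a unique monad morphism $\widehat e:T(H+V)\to T(H+V)$ with $\widehat e\cdot\kappa^{H+V}=[\kappa^{H+V}\cdot\mathrm{inl},e]$. A flat equation morphism in $A$ (for $H$) is $d:X\to HX+A$; a solution in an $H$-algebra $(A,a)$ is $s:X\to A$ with $s=[a,A]\cdot(Hs+A)\cdot d$. $(A,a)$ is a completely iterative algebra (cia) if every flat equation morphism in $A$ has a unique solution. Every non-empty algebra for a contracting endofunctor of $\mathsf{CMS}$ is a cia (known fact); in particular, for every non-expanding $f:VA\to A$, $[a,f]:(H+V)A\to A$ is a cia for $H+V$, and $\widetilde{[a,f]}:T(H+V)A\to A$ denotes its evaluation morphism, i.e. the unique solution of the flat equation morphism $\alpha^{H+V}_A:T(H+V)A\to(H+V)T(H+V)A+A$. A complete Elgot algebra for an endofunctor $H$ is an $H$-algebra $(A,a)$ with an operation $(\,\_\,)^*$ assigning to every flat equation morphism in $A$ a solution, satisfying: (Functoriality) if $e:X\to HX+A$, $f:Y\to HY+A$, $h:X\to Y$ satisfy $f\cdot h=(Hh+A)\cdot e$, then $e^*=f^*\cdot h$; (Compositionality)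 for $e:X\to HX+Y$, $f:Y\to HY+A$, $((HX+f^*)\cdot e)^*=\bigl(([H\mathrm{inl},H\mathrm{inr}]+A)\cdot(HX+f)\cdot[e,\mathrm{inr}]\bigr)^*\cdot\mathrm{inl}$. Every cia is a complete Elgot algebra in a unique way. An interpreted solution of $e$ in $A$ is a morphism $e^\ddagger_A:VA\to A$ such that there is an operation $(\,\_\,)^+$ making $(A,[a,e^\ddagger_A],(\,\_\,)^+)$ a complete Elgot algebra for $H+V$ whose evaluation morphism $\beta=(\alpha^{H+V}_A)^+:T(H+V)A\to A$ satisfies $\beta\cdot\widehat e_A=\beta$. For $(A,a)$ a cia, every guarded recursive program scheme has a unique interpreted solution in $A$. -}

module Defs where

open import Data.Empty using (⊥-elim)
import Data.Integer.Base as ℤ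
import Data.Integer.Properties as ℤ
open import Data.Nat.Base as ℕ using (ℕ; zero; suc)
open import Data.Nat.Coprimality using (1-coprimeTo) renaming (sym to coprime-sym)
import Data.Nat.Properties as ℕ
open import Data.Product using (Σ; ∃-syntax; ∃!; _×_; _,_; proj₁; proj₂)
open import Data.Rational.Base as ℚ using (ℚ; 0ℚ; 1ℚ; ½; mkℚ)
import Data.Rational.Properties as ℚ
open import Data.Rational.Solver using (module +-*-Solver)
import Data.Rational.Unnormalised.Base as ℚᵘ
import Data.Rational.Unnormalised.Properties as ℚᵘ
open import Data.Sum.Base using (_⊎_; inj₁; inj₂)
open import Data.Unit.Base using (⊤; tt)
open import Function.Metric.Structures using (IsGeneralMetric)
open import Level using (Level; 0ℓ; _⊔_) renaming (suc to lsuc)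
open import Relation.Binary.Bundles using (Setoid)
open import Relation.Binary.PropositionalEquality as ≡ using (_≡_; refl; cong; subst)
import Relation.Binary.Reasoning.Setoid as SetoidReasoning
open import Relation.Binary.Structures using (IsEquivalence; IsPartialOrder)
open import Relation.Nullary using (¬_)

module Rationals where
  ι : ℕ → ℚ
  ι n = mkℚ (ℤ.+ n) 0 (coprime-sym (1-coprimeTo n))

  ι-suc : ∀ n → ι (suc n) ≡ 1ℚ ℚ.+ ι n
  ι-suc n = ℚ.toℚᵘ-injective (ℚᵘ.≃-trans (ℚᵘ.*≡* lemma) (ℚᵘ.≃-sym (ℚ.toℚᵘ-homo-+ 1ℚ (ι n))))
    where
    lemma : ℤ.+ suc n ℤ.* ℤ.+ 1 ≡ (ℤ.+ 1 ℤ.* ℤ.+ 1 ℤ.+ ℤ.+ n ℤ.* ℤ.+ 1) ℤ.* ℤ.+ 1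
    lemma = cong (ℤ._* ℤ.+ 1) (cong (λ z → (ℤ.+ 1) ℤ.+ z) (≡.sym (ℤ.*-identityʳ (ℤ.+ n))))

  archimedean : ∀ x → 0ℚ ℚ.< x → ∃[ n ] 1ℚ ℚ.≤ x ℚ.* ι n
  archimedean x@(mkℚ (ℤ.+ zero) _ _) (ℚ.*<* (ℤ.+<+ ()))
  archimedean x@(mkℚ ℤ.-[1+ _ ] _ _) (ℚ.*<* ())
  archimedean x@(mkℚ (ℤ.+ suc a) d _) _ = suc d , (begin
    1ℚ              ≡⟨ ℚ.*-inverseʳ x ⟨
    x ℚ.* ℚ.1/ x    ≤⟨ ℚ.*-monoˡ-≤-nonNeg x {ℚ.1/ x} {ι (suc d)} (ℚ.*≤* (ℤ.*-monoˡ-≤-nonNeg (ℤ.+ suc d) {ℤ.+ 1} {ℤ.+ suc a} (ℤ.+≤+ (ℕ.s≤s ℕ.z≤n)))) ⟩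
    x ℚ.* ι (suc d) ∎)
    where open ℚ.≤-Reasoning

  0≤ι : ∀ n → 0ℚ ℚ.≤ ι n
  0≤ι n = ℚ.nonNegative⁻¹ (ι n)

  *-nonneg : ∀ {p q} → 0ℚ ℚ.≤ p → 0ℚ ℚ.≤ q → 0ℚ ℚ.≤ p ℚ.* q
  *-nonneg {p} {q} 0≤p 0≤q = ℚ.nonNegative⁻¹ (p ℚ.* q)
    where instance
      _ = ℚ.nonNeg*nonNeg⇒nonNeg p {{ℚ.nonNegative 0≤p}} q {{ℚ.nonNegative 0≤q}}

  *-mono : ∀ {p p′ q q′} → 0ℚ ℚ.≤ p → 0ℚ ℚ.≤ q′ → p ℚ.≤ p′ → q ℚ.≤ q′ → p ℚ.* q ℚ.≤ p′ ℚ.* q′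
  *-mono {p} {p′} {q} {q′} 0≤p 0≤q′ p≤p′ q≤q′ = ℚ.≤-trans
    (ℚ.*-monoˡ-≤-nonNeg p {{ℚ.nonNegative 0≤p}} q≤q′)
    (ℚ.*-monoʳ-≤-nonNeg q′ {{ℚ.nonNegative 0≤q′}} p≤p′)

  *-pos : ∀ {p q} → 0ℚ ℚ.< p → 0ℚ ℚ.< q → 0ℚ ℚ.< p ℚ.* q
  *-pos {p} {q} 0<p 0<q = subst (ℚ._< p ℚ.* q) (ℚ.*-zeroʳ p) (ℚ.*-monoʳ-<-pos p {{ℚ.positive 0<p}} 0<q)

  +-nonneg : ∀ {p q} → 0ℚ ℚ.≤ p → 0ℚ ℚ.≤ q → 0ℚ ℚ.≤ p ℚ.+ q
  +-nonneg = ℚ.+-mono-≤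

  0<-diff : ∀ {p q} → p ℚ.< q → 0ℚ ℚ.< q ℚ.- p
  0<-diff {p} {q} p<q = subst (ℚ._< q ℚ.- p) (ℚ.+-inverseʳ p) (ℚ.+-monoˡ-< (ℚ.- p) p<q)

  -- room for two equal positive steps between p < q
  half : ∀ {p q} → p ℚ.< q → ∃[ δ ] 0ℚ ℚ.< δ × p ℚ.+ (δ ℚ.+ δ) ≡ q
  half {p} {q} p<q = (q ℚ.- p) ℚ.* ½ , *-pos (0<-diff p<q) (ℚ.positive⁻¹ ½) ,
    ≡.trans (cong (p ℚ.+_) (≡.sym (ℚ.*-distribˡ-+ (q ℚ.- p) ½ ½)))
      (solve 2 (λ p q → p :+ (q :- p) :* con 1ℚ := q) refl p q)
    where open +-*-Solver

  ≤-closed : ∀ {p q} → (∀ r → q ℚ.< r → p ℚ.≤ r) → p ℚ.≤ q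
  ≤-closed {p} {q} h = ℚ.≮⇒≥ λ q<p → let m , q<m , m<p = ℚ.<-dense q<p in
    ℚ.<-irrefl refl (ℚ.<-≤-trans m<p (h m q<m))

  _^_ : ℚ → ℕ → ℚ
  ε ^ zero  = 1ℚ
  ε ^ suc n = ε ℚ.* ε ^ n

  module Powers (ε : ℚ) (0≤ε : 0ℚ ℚ.≤ ε) (ε<1 : ε ℚ.< 1ℚ) where
    ^-nonneg : ∀ n → 0ℚ ℚ.≤ ε ^ n
    ^-nonneg zero    = ℚ.nonNegative⁻¹ 1ℚ
    ^-nonneg (suc n) = *-nonneg 0≤ε (^-nonneg n)

    ^-suc : ∀ n → ε ^ suc n ℚ.≤ ε ^ n
    ^-suc n = subst (ε ^ suc n ℚ.≤_) (ℚ.*-identityˡ _)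
      (*-mono 0≤ε (^-nonneg n) (ℚ.<⇒≤ ε<1) ℚ.≤-refl)

    ^-anti : ∀ n k → ε ^ (n ℕ.+ k) ℚ.≤ ε ^ n
    ^-anti n zero    = subst (λ m → ε ^ m ℚ.≤ ε ^ n) (≡.sym (ℕ.+-identityʳ n)) ℚ.≤-refl
    ^-anti n (suc k) = subst (λ m → ε ^ m ℚ.≤ ε ^ n) (≡.sym (ℕ.+-suc n k))
      (ℚ.≤-trans (^-suc (n ℕ.+ k)) (^-anti n k))

    ^-≤1 : ∀ n → ε ^ n ℚ.≤ 1ℚ
    ^-≤1 n = ^-anti 0 n

    c : ℚ
    c = 1ℚ ℚ.- ε

    0<c : 0ℚ ℚ.< c
    0<c = 0<-diff ε<1

    bernoulli : ∀ n → ε ^ n ℚ.* (1ℚ ℚ.+ ι n ℚ.* c) ℚ.≤ 1ℚ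
    bernoulli zero    = ℚ.≤-reflexive (≡.trans (ℚ.*-identityˡ _)
      (≡.trans (cong (1ℚ ℚ.+_) (ℚ.*-zeroˡ c)) (ℚ.+-identityʳ 1ℚ)))
    bernoulli (suc n) = begin
      ε ℚ.* ε ^ n ℚ.* (1ℚ ℚ.+ ι (suc n) ℚ.* c)
        ≡⟨ cong (λ z → ε ℚ.* ε ^ n ℚ.* (1ℚ ℚ.+ z ℚ.* c)) (ι-suc n) ⟩
      ε ℚ.* ε ^ n ℚ.* (1ℚ ℚ.+ (1ℚ ℚ.+ ι n) ℚ.* c)
        ≡⟨ solve 3 (λ e p i → e :* p :* (con 1ℚ :+ (con 1ℚ :+ i) :* (con 1ℚ :- e))
                           := p :* (con 1ℚ :+ i :* (con 1ℚ :- e))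
                              :- p :* ((con 1ℚ :+ i) :* ((con 1ℚ :- e) :* (con 1ℚ :- e))))
             refl ε (ε ^ n) (ι n) ⟩
      ε ^ n ℚ.* (1ℚ ℚ.+ ι n ℚ.* c) ℚ.- ε ^ n ℚ.* ((1ℚ ℚ.+ ι n) ℚ.* (c ℚ.* c))
        ≤⟨ ℚ.+-monoʳ-≤ (ε ^ n ℚ.* (1ℚ ℚ.+ ι n ℚ.* c)) (ℚ.neg-antimono-≤
             (*-nonneg (^-nonneg n) (*-nonneg (+-nonneg (ℚ.nonNegative⁻¹ 1ℚ) (0≤ι n))
               (*-nonneg (ℚ.<⇒≤ 0<c) (ℚ.<⇒≤ 0<c))))) ⟩
      ε ^ n ℚ.* (1ℚ ℚ.+ ι n ℚ.* c) ℚ.+ 0ℚ  ≡⟨ ℚ.+-identityʳ _ ⟩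
      ε ^ n ℚ.* (1ℚ ℚ.+ ι n ℚ.* c)         ≤⟨ bernoulli n ⟩
      1ℚ                                    ∎
      where
      open ℚ.≤-Reasoning
      open +-*-Solver

    ^-small : ∀ δ → 0ℚ ℚ.< δ → ∃[ n ] ε ^ n ℚ.≤ δ
    ^-small δ 0<δ = let n , 1≤ = archimedean (δ ℚ.* c) (*-pos 0<δ 0<c) in n , (begin
      ε ^ n                                ≡⟨ ℚ.*-identityʳ _ ⟨
      ε ^ n ℚ.* 1ℚ                         ≤⟨ *-mono (^-nonneg n) (0≤δcι n) ℚ.≤-refl 1≤ ⟩
      ε ^ n ℚ.* (δ ℚ.* c ℚ.* ι n)          ≡⟨ solve 4 (λ p d c i → p :* (d :* c :* i) := d :* (p :* (i :* c)))
                                                refl (ε ^ n) δ c (ι n) ⟩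
      δ ℚ.* (ε ^ n ℚ.* (ι n ℚ.* c))        ≤⟨ *-mono (ℚ.<⇒≤ 0<δ) (ℚ.nonNegative⁻¹ 1ℚ) ℚ.≤-refl (ℚ.≤-trans
                                                (*-mono (^-nonneg n) (+-nonneg (ℚ.nonNegative⁻¹ 1ℚ) (0≤ιc n)) ℚ.≤-refl
                                                  (subst (ℚ._≤ 1ℚ ℚ.+ ι n ℚ.* c) (ℚ.+-identityˡ _)
                                                    (ℚ.+-monoˡ-≤ (ι n ℚ.* c) (ℚ.nonNegative⁻¹ 1ℚ))))
                                                (bernoulli n)) ⟩
      δ ℚ.* 1ℚ                             ≡⟨ ℚ.*-identityʳ δ ⟩
      δ                                    ∎)
      where
      open ℚ.≤-Reasoning
      open +-*-Solver
      0≤ιc : ∀ n → 0ℚ ℚ.≤ ι n ℚ.* c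
      0≤ιc n = *-nonneg (0≤ι n) (ℚ.<⇒≤ 0<c)
      0≤δcι : ∀ n → 0ℚ ℚ.≤ δ ℚ.* c ℚ.* ι n
      0≤δcι n = *-nonneg (*-nonneg (ℚ.<⇒≤ 0<δ) (ℚ.<⇒≤ 0<c)) (0≤ι n)

open Rationals

-- The elements of [0,∞], each given by the rationals that bound it from above:
-- x ≼ q says that x is at most q.  Classically these upward closed cuts,
-- closed under infima, are exactly the extended nonnegative reals; the one-sided
-- presentation is what makes all suprema, such as the distance of two maps,
-- available without excluded middle.
record ℝ⁺ : Set₁ where
  infix 4 _≼_
  field
    _≼_    : ℚ → Set
    nonneg : ∀ {q} → _≼_ q → 0ℚ ℚ.≤ q
    upper  : ∀ {p q} → p ℚ.≤ q → _≼_ p → _≼_ q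
    closed : ∀ {q} → (∀ r → q ℚ.< r → _≼_ r) → _≼_ q

open ℝ⁺ public

infix  4 _≤_ _≃_ _<_
infixl 6 _+_
infixl 7 _*_

_≤_ : ℝ⁺ → ℝ⁺ → Set
x ≤ y = ∀ q → y ≼ q → x ≼ q

_≃_ : ℝ⁺ → ℝ⁺ → Set
x ≃ y = x ≤ y × y ≤ x

_<_ : ℝ⁺ → ℝ⁺ → Set
x < y = ∃[ q ] x ≼ q × ¬ (y ≼ q)

fromℚ : (q : ℚ) → 0ℚ ℚ.≤ q → ℝ⁺
fromℚ p 0≤p = record
  { _≼_    = λ q → p ℚ.≤ q
  ; nonneg = ℚ.≤-trans 0≤p
  ; upper  = λ p≤q r≤p → ℚ.≤-trans r≤p p≤q
  ; closed = ≤-closed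
  }

0ℝ 1ℝ : ℝ⁺
0ℝ = fromℚ 0ℚ ℚ.≤-refl
1ℝ = fromℚ 1ℚ (ℚ.nonNegative⁻¹ 1ℚ)

private
  nonneg-closed : ∀ {q} → (∀ r → q ℚ.< r → 0ℚ ℚ.≤ r) → 0ℚ ℚ.≤ q
  nonneg-closed = ≤-closed

  dense-closed : {P : ℚ → Set} → ∀ {q} →
                 (∀ r → q ℚ.< r → ∀ s → r ℚ.< s → P s) → ∀ s → q ℚ.< s → P s
  dense-closed h s q<s = let r , q<r , r<s = ℚ.<-dense q<s in h r q<r s r<s

_+_ : ℝ⁺ → ℝ⁺ → ℝ⁺
x + y = record
  { _≼_    = λ q → ∀ r → q ℚ.< r → ∃[ a ] ∃[ b ] x ≼ a × y ≼ b × a ℚ.+ b ℚ.≤ r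
  ; nonneg = λ h → nonneg-closed λ r q<r → let a , b , x≼a , y≼b , a+b≤r = h r q<r in
               ℚ.≤-trans (+-nonneg (nonneg x x≼a) (nonneg y y≼b)) a+b≤r
  ; upper  = λ p≤q h r q<r → h r (ℚ.≤-<-trans p≤q q<r)
  ; closed = dense-closed
  }

_*_ : ℝ⁺ → ℝ⁺ → ℝ⁺
x * y = record
  { _≼_    = λ q → ∀ r → q ℚ.< r → ∃[ a ] ∃[ b ] x ≼ a × y ≼ b × a ℚ.* b ℚ.≤ r
  ; nonneg = λ h → nonneg-closed λ r q<r → let a , b , x≼a , y≼b , ab≤r = h r q<r in
               ℚ.≤-trans (*-nonneg (nonneg x x≼a) (nonneg y y≼b)) ab≤r
  ; upper  = λ p≤q h r q<r → h r (ℚ.≤-<-trans p≤q q<r)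
  ; closed = dense-closed
  }

-- The bound 0ℚ ≤ q makes the supremum of the empty family 0.
sup : {I : Set} → (I → ℝ⁺) → ℝ⁺
sup x = record
  { _≼_    = λ q → 0ℚ ℚ.≤ q × (∀ i → x i ≼ q)
  ; nonneg = proj₁
  ; upper  = λ p≤q (0≤p , h) → ℚ.≤-trans 0≤p p≤q , λ i → upper (x i) p≤q (h i)
  ; closed = λ h → nonneg-closed (λ r q<r → proj₁ (h r q<r)) ,
               λ i → closed (x i) λ r q<r → proj₂ (h r q<r) i
  }

≤-refl : ∀ {x} → x ≤ x
≤-refl q x≼q = x≼q

≤-isPartialOrder : IsPartialOrder _≃_ _≤_
≤-isPartialOrder = record
  { isPreorder = record
    { isEquivalence = record
      { refl  = λ {x} → ≤-refl {x} , ≤-refl {x}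
      ; sym   = λ (p , q) → q , p
      ; trans = λ (p , q) (r , s) → (λ _ h → p _ (r _ h)) , (λ _ h → s _ (q _ h))
      }
    ; reflexive = proj₁
    ; trans     = λ p q _ h → p _ (q _ h)
    }
  ; antisym = _,_
  }

module _ {X : Set} (d : X → X → ℝ⁺) where

  Cauchy : (ℕ → X) → Set
  Cauchy s = ∀ δ → 0ℚ ℚ.< δ → ∃[ N ] ∀ m n → N ℕ.≤ m → N ℕ.≤ n → d (s m) (s n) ≼ δ

  _ConvergesTo_ : (ℕ → X) → X → Set
  s ConvergesTo l = ∀ δ → 0ℚ ℚ.< δ → ∃[ N ] ∀ n → N ℕ.≤ n → d (s n) l ≼ δ

-- A complete metric space with distances in [0,1]; the points form a setoid.
record Space : Set₁ where
  infix 4 _≈_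
  field
    ∣_∣             : Set
    _≈_             : ∣_∣ → ∣_∣ → Set
    d               : ∣_∣ → ∣_∣ → ℝ⁺
    isGeneralMetric : IsGeneralMetric _≈_ _≃_ _≤_ 0ℝ _+_ d
    bounded         : ∀ x y → d x y ≤ 1ℝ
    complete        : ∀ s → Cauchy d s → ∃[ l ] _ConvergesTo_ d s l

  private module M = IsGeneralMetric isGeneralMetric

  ≈-equiv : IsEquivalence _≈_
  ≈-equiv = M.≈-isEquivalence

  open IsEquivalence ≈-equiv public
    renaming (refl to ≈-refl; sym to ≈-sym; trans to ≈-trans)

  ≈⇒≼ : ∀ {x y} → x ≈ y → d x y ≼ 0ℚ
  ≈⇒≼ x≈y = proj₁ (M.≈⇒0 x≈y) 0ℚ ℚ.≤-refl

  ≼⇒≈ : ∀ {x y} → d x y ≼ 0ℚ → x ≈ y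
  ≼⇒≈ {x} {y} h = M.0⇒≈ ((λ q 0≤q → upper (d x y) 0≤q h) , λ q → nonneg (d x y))

  d-sym : ∀ {x y q} → d x y ≼ q → d y x ≼ q
  d-sym {x} {y} = proj₂ (M.sym x y) _

  triangle : ∀ {x y z p q} → d x y ≼ p → d y z ≼ q → d x z ≼ p ℚ.+ q
  triangle {x} {y} {z} h k = M.triangle x y z _ λ r p+q<r → _ , _ , h , k , ℚ.<⇒≤ p+q<r

  d≼1 : ∀ {x y} → d x y ≼ 1ℚ
  d≼1 = bounded _ _ 1ℚ ℚ.≤-refl

  d-resp : ∀ {x x′ y y′ q} → x ≈ x′ → y ≈ y′ → d x′ y′ ≼ q → d x y ≼ q
  d-resp {x} {x′} {y} {y′} {q} x≈x′ y≈y′ = proj₁ (M.cong x≈x′ y≈y′) q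

  -- a bound up to arbitrarily small errors is a bound
  module _ {ε : ℚ} (0≤ε : 0ℚ ℚ.≤ ε) (ε<1 : ε ℚ.< 1ℚ) where
    open Powers ε 0≤ε ε<1

    squeeze : ∀ {x y q} → (∀ n → d x y ≼ q ℚ.+ (ε ^ n ℚ.+ ε ^ n)) → d x y ≼ q
    squeeze {x} {y} {q} h = closed (d x y) λ r q<r →
      let δ , 0<δ , eq = half q<r
          n , ε^n≤δ = ^-small δ 0<δ
      in upper (d x y) (subst (q ℚ.+ (ε ^ n ℚ.+ ε ^ n) ℚ.≤_) eq (ℚ.+-monoʳ-≤ q (ℚ.+-mono-≤ ε^n≤δ ε^n≤δ))) (h n)

    ≈-squeeze : ∀ {x y} → (∀ n → d x y ≼ ε ^ n ℚ.+ ε ^ n) → x ≈ y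
    ≈-squeeze {x} {y} h = ≼⇒≈ (squeeze λ n → subst (d x y ≼_) (≡.sym (ℚ.+-identityˡ _)) (h n))

    limit : (s : ℕ → ∣_∣) → (∀ n k → d (s n) (s (n ℕ.+ k)) ≼ ε ^ n) →
            ∃[ l ] ∀ n → d (s n) l ≼ ε ^ n
    limit s step = l , λ n → closed (d (s n) l) λ r ε^n<r →
        let δ , 0<δ , eq = half ε^n<r
            N , h = conv δ 0<δ
        in upper (d (s n) l)
             (subst (ε ^ n ℚ.+ δ ℚ.≤_) eq (ℚ.+-monoʳ-≤ (ε ^ n)
                (subst (ℚ._≤ δ ℚ.+ δ) (ℚ.+-identityʳ δ) (ℚ.+-monoʳ-≤ δ (ℚ.<⇒≤ 0<δ)))))
             (triangle (step n N) (h (n ℕ.+ N) (ℕ.m≤n+m N n)))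
      where
      cauchy : Cauchy d s
      cauchy δ 0<δ =
        let η , 0<η , eq = half 0<δ
            N , ε^N≤η = ^-small η 0<η
            close : ∀ m → N ℕ.≤ m → d (s N) (s m) ≼ η
            close m N≤m = upper (d (s N) (s m)) ε^N≤η
              (subst (λ k → d (s N) (s k) ≼ ε ^ N) (ℕ.m+[n∸m]≡n N≤m) (step N (m ℕ.∸ N)))
        in N , λ m n N≤m N≤n → subst (d (s m) (s n) ≼_) (≡.trans (≡.sym (ℚ.+-identityˡ _)) eq)
             (triangle (d-sym (close m N≤m)) (close n N≤n))
      l = proj₁ (complete s cauchy)
      conv = proj₂ (complete s cauchy)

  uniform : ∀ {s l δ N} → _ConvergesTo_ d s l → (∀ m n → N ℕ.≤ m → N ℕ.≤ n → d (s m) (s n) ≼ δ) →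
            ∀ n → N ℕ.≤ n → d (s n) l ≼ δ
  uniform {s} {l} {δ} {N} conv h n N≤n = closed (d (s n) l) λ r δ<r →
    let η , 0<η , eq = half δ<r
        M , k = conv η 0<η
    in upper (d (s n) l)
         (subst (δ ℚ.+ η ℚ.≤_) eq (ℚ.+-monoʳ-≤ δ
            (subst (ℚ._≤ η ℚ.+ η) (ℚ.+-identityʳ η) (ℚ.+-monoʳ-≤ η (ℚ.<⇒≤ 0<η)))))
         (triangle (h n (M ℕ.⊔ N) N≤n (ℕ.m≤n⊔m M N)) (k (M ℕ.⊔ N) (ℕ.m≤m⊔n M N)))

open Space public using (∣_∣)

-- equality of points is d x y = 0
mkSpace : (X : Set) (d : X → X → ℝ⁺) →
  (∀ x → d x x ≼ 0ℚ) →
  (∀ {x y q} → d x y ≼ q → d y x ≼ q) →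
  (∀ {x y z p q} → d x y ≼ p → d y z ≼ q → d x z ≼ p ℚ.+ q) →
  (∀ x y → d x y ≼ 1ℚ) →
  (∀ s → Cauchy d s → ∃[ l ] _ConvergesTo_ d s l) → Space
mkSpace X d d-refl d-sym d-tri d≼1 complete = record
  { ∣_∣ = X
  ; _≈_ = λ x y → d x y ≼ 0ℚ
  ; d = d
  ; isGeneralMetric = record
    { isSemiMetric = record
      { isQuasiSemiMetric = record
        { isPreMetric = record
          { isProtoMetric = record
            { isPartialOrder  = ≤-isPartialOrder
            ; ≈-isEquivalence = record { refl = d-refl _ ; sym = d-sym ; trans = d-tri }
            ; cong            = λ h k → resp (d-sym h) (d-sym k) , resp h k
            ; nonNegative     = λ {x} {y} q → nonneg (d x y)
            }
          ; ≈⇒0 = λ {x} {y} h → (λ q 0≤q → upper (d x y) 0≤q h) , λ q → nonneg (d x y)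
          }
        ; 0⇒≈ = λ h → proj₁ h 0ℚ ℚ.≤-refl
        }
      ; sym = λ x y → (λ q → d-sym) , (λ q → d-sym)
      }
    ; triangle = λ x y z q h → closed (d x z) λ r q<r →
        let a , b , h₁ , h₂ , a+b≤r = h r q<r in upper (d x z) a+b≤r (d-tri h₁ h₂)
    }
  ; bounded  = λ x y q 1≤q → upper (d x y) 1≤q (d≼1 x y)
  ; complete = complete
  }
  where
  resp : ∀ {x x′ y y′} → d x x′ ≼ 0ℚ → d y y′ ≼ 0ℚ → d x′ y′ ≤ d x y
  resp {x} {x′} {y} {y′} h k q l = subst (d x′ y′ ≼_)
    (≡.trans (ℚ.+-identityʳ (0ℚ ℚ.+ q)) (ℚ.+-identityˡ q)) (d-tri (d-tri (d-sym h) l) k)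

record Category (o ℓ e : Level) : Set (lsuc (o ⊔ ℓ ⊔ e)) where
  infix  4 _⇒_ _≈_
  infixr 9 _∘_
  field
    Obj       : Set o
    _⇒_       : Obj → Obj → Set ℓ
    _≈_       : ∀ {A B} → A ⇒ B → A ⇒ B → Set e
    equiv     : ∀ {A B} → IsEquivalence (_≈_ {A} {B})
    id        : ∀ {A} → A ⇒ A
    _∘_       : ∀ {A B C} → B ⇒ C → A ⇒ B → A ⇒ C
    ∘-resp-≈  : ∀ {A B C} {f f′ : B ⇒ C} {g g′ : A ⇒ B} → f ≈ f′ → g ≈ g′ → f ∘ g ≈ f′ ∘ g′
    assoc     : ∀ {A B C D} {f : A ⇒ B} {g : B ⇒ C} {h : C ⇒ D} → (h ∘ g) ∘ f ≈ h ∘ (g ∘ f)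
    identityˡ : ∀ {A B} {f : A ⇒ B} → id ∘ f ≈ f
    identityʳ : ∀ {A B} {f : A ⇒ B} → f ∘ id ≈ f

record Coproducts {o ℓ e} (C : Category o ℓ e) : Set (o ⊔ ℓ ⊔ e) where
  open Category C
  infixr 6 _⨿_
  field
    _⨿_     : Obj → Obj → Obj
    inl     : ∀ {A B} → A ⇒ A ⨿ B
    inr     : ∀ {A B} → B ⇒ A ⨿ B
    [_,_]   : ∀ {A B X} → A ⇒ X → B ⇒ X → A ⨿ B ⇒ X
    inject₁ : ∀ {A B X} {f : A ⇒ X} {g : B ⇒ X} → [ f , g ] ∘ inl ≈ f
    inject₂ : ∀ {A B X} {f : A ⇒ X} {g : B ⇒ X} → [ f , g ] ∘ inr ≈ g
    unique  : ∀ {A B X} {f : A ⇒ X} {g : B ⇒ X} {h : A ⨿ B ⇒ X} →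
              h ∘ inl ≈ f → h ∘ inr ≈ g → [ f , g ] ≈ h

module Iteration {o ℓ e} (C : Category o ℓ e) (P : Coproducts C) where
  open Category C
  open Coproducts P

  private variable
    A B X Y Z W : Obj

  module MorphismReasoning where
    hom : Obj → Obj → Setoid ℓ e
    hom A B = record { isEquivalence = equiv {A} {B} }

    module R {A B : Obj} = SetoidReasoning (hom A B)
    open R public

    ≈-refl : {f : A ⇒ B} → f ≈ f
    ≈-refl = IsEquivalence.refl equiv

    ≈-sym : {f g : A ⇒ B} → f ≈ g → g ≈ f
    ≈-sym = IsEquivalence.sym equiv

    infixr 5 _∙_
    _∙_ : {f g h : A ⇒ B} → f ≈ g → g ≈ h → f ≈ h
    _∙_ = IsEquivalence.trans equiv

    ∘-congʳ : {f : Y ⇒ Z} {g g′ : X ⇒ Y} → g ≈ g′ → f ∘ g ≈ f ∘ g′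
    ∘-congʳ = ∘-resp-≈ ≈-refl

    ∘-congˡ : {f f′ : Y ⇒ Z} {g : X ⇒ Y} → f ≈ f′ → f ∘ g ≈ f′ ∘ g
    ∘-congˡ p = ∘-resp-≈ p ≈-refl

    pullˡ : {f : Y ⇒ Z} {g : X ⇒ Y} {h : X ⇒ Z} {k : W ⇒ X} → f ∘ g ≈ h → f ∘ g ∘ k ≈ h ∘ k
    pullˡ p = ≈-sym assoc ∙ ∘-congˡ p

    pushˡ : {f : Y ⇒ Z} {g : X ⇒ Y} {h : X ⇒ Z} {k : W ⇒ X} → h ≈ f ∘ g → h ∘ k ≈ f ∘ g ∘ k
    pushˡ p = ∘-congˡ p ∙ assoc

    extendʳ : {f : Y ⇒ Z} {g : X ⇒ Y} {f′ : B ⇒ Z} {g′ : X ⇒ B} {k : W ⇒ X} →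
              f ∘ g ≈ f′ ∘ g′ → f ∘ g ∘ k ≈ f′ ∘ g′ ∘ k
    extendʳ p = ≈-sym assoc ∙ ∘-congˡ p ∙ assoc

    []-cong : {f f′ : A ⇒ X} {g g′ : B ⇒ X} → f ≈ f′ → g ≈ g′ → [ f , g ] ≈ [ f′ , g′ ]
    []-cong p q = unique (inject₁ ∙ ≈-sym p) (inject₂ ∙ ≈-sym q)

    ∘-[] : {f : A ⇒ X} {g : B ⇒ X} {h : X ⇒ Y} → [ h ∘ f , h ∘ g ] ≈ h ∘ [ f , g ]
    ∘-[] = unique (assoc ∙ ∘-congʳ inject₁) (assoc ∙ ∘-congʳ inject₂)

    +-ext : {h k : A ⨿ B ⇒ X} → h ∘ inl ≈ k ∘ inl → h ∘ inr ≈ k ∘ inr → h ≈ k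
    +-ext p q = ≈-sym (unique p q) ∙ unique ≈-refl ≈-refl

  open MorphismReasoning

  infixr 6 _+₁_
  _+₁_ : A ⇒ X → B ⇒ Y → A ⨿ B ⇒ X ⨿ Y
  f +₁ g = [ inl ∘ f , inr ∘ g ]

  assocˡ : A ⨿ (B ⨿ X) ⇒ (A ⨿ B) ⨿ X
  assocˡ = [ inl ∘ inl , [ inl ∘ inr , inr ] ]

  private
    []∘+₁ : {f : X ⇒ Z} {g : Y ⇒ Z} {h : A ⇒ X} {k : B ⇒ Y} → [ f , g ] ∘ (h +₁ k) ≈ [ f ∘ h , g ∘ k ]
    []∘+₁ = ≈-sym ∘-[] ∙ []-cong (pullˡ inject₁) (pullˡ inject₂)

    +₁-cong : {f f′ : A ⇒ X} {g g′ : B ⇒ Y} → f ≈ f′ → g ≈ g′ → f +₁ g ≈ f′ +₁ g′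
    +₁-cong p q = []-cong (∘-congʳ p) (∘-congʳ q)

    +₁-∘ : {f : X ⇒ Z} {g : Y ⇒ W} {h : A ⇒ X} {k : B ⇒ Y} → (f +₁ g) ∘ (h +₁ k) ≈ f ∘ h +₁ g ∘ k
    +₁-∘ = []∘+₁ ∙ []-cong assoc assoc

    +₁-id : id {A} +₁ id {B} ≈ id
    +₁-id = unique (identityˡ ∙ ≈-sym identityʳ) (identityˡ ∙ ≈-sym identityʳ)

  record Endofunctor : Set (o ⊔ ℓ ⊔ e) where
    field
      F₀           : Obj → Obj
      F₁           : A ⇒ B → F₀ A ⇒ F₀ B
      identity     : F₁ (id {A}) ≈ id
      homomorphism : {f : X ⇒ Y} {g : Y ⇒ Z} → F₁ (g ∘ f) ≈ F₁ g ∘ F₁ f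
      F-resp-≈     : {f g : X ⇒ Y} → f ≈ g → F₁ f ≈ F₁ g

  open Endofunctor public using (F₀; F₁)
  open Endofunctor

  _∘F_ : Endofunctor → Endofunctor → Endofunctor
  F ∘F G = record
    { F₀           = λ X → F₀ F (F₀ G X)
    ; F₁           = λ f → F₁ F (F₁ G f)
    ; identity     = F-resp-≈ F (identity G) ∙ identity F
    ; homomorphism = F-resp-≈ F (homomorphism G) ∙ homomorphism F
    ; F-resp-≈     = λ p → F-resp-≈ F (F-resp-≈ G p)
    }

  const : Obj → Endofunctor
  const X = record
    { F₀           = λ _ → X
    ; F₁           = λ _ → id
    ; identity     = ≈-refl
    ; homomorphism = ≈-sym identityˡ
    ; F-resp-≈     = λ _ → ≈-refl
    }

  infixr 6 _⊕_
  _⊕_ : Endofunctor → Endofunctor → Endofunctor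
  F ⊕ G = record
    { F₀           = λ X → F₀ F X ⨿ F₀ G X
    ; F₁           = λ f → F₁ F f +₁ F₁ G f
    ; identity     = +₁-cong (identity F) (identity G) ∙ +₁-id
    ; homomorphism = +₁-cong (homomorphism F) (homomorphism G) ∙ ≈-sym +₁-∘
    ; F-resp-≈     = λ p → +₁-cong (F-resp-≈ F p) (F-resp-≈ G p)
    }

  record NatTrans (F G : Endofunctor) : Set (o ⊔ ℓ ⊔ e) where
    field
      component : ∀ X → F₀ F X ⇒ F₀ G X
      natural   : (f : X ⇒ Y) → component Y ∘ F₁ F f ≈ F₁ G f ∘ component X

  open NatTrans public using () renaming (component to infixl 10 _at_)
  open NatTrans

  record FinalCoalgebra (F : Endofunctor) : Set (o ⊔ ℓ ⊔ e) where
    field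
      carrier   : Obj
      structure : carrier ⇒ F₀ F carrier
      final     : ∀ {Y} (c : Y ⇒ F₀ F Y) → ∃! _≈_ λ h → structure ∘ h ≈ F₁ F h ∘ c

  Iteratable : Endofunctor → Set (o ⊔ ℓ ⊔ e)
  Iteratable H = ∀ X → FinalCoalgebra (H ⊕ const X)

  module _ (H : Endofunctor) where

    IsSolution : F₀ H A ⇒ A → X ⇒ F₀ H X ⨿ A → X ⇒ A → Set e
    IsSolution a d s = s ≈ [ a , id ] ∘ (F₁ H s +₁ id) ∘ d

    CIA : F₀ H A ⇒ A → Set (o ⊔ ℓ ⊔ e)
    CIA {A} a = ∀ {X} (d : X ⇒ F₀ H X ⨿ A) → ∃! _≈_ (IsSolution a d)

    -- That (_)* respects ≈ is functoriality for h = id.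
    record CompleteElgot {A : Obj} (a : F₀ H A ⇒ A) : Set (o ⊔ ℓ ⊔ e) where
      infix 10 _*
      field
        _* : X ⇒ F₀ H X ⨿ A → X ⇒ A
        solution : (d : X ⇒ F₀ H X ⨿ A) → IsSolution a d (d *)
        functoriality :
          (d : X ⇒ F₀ H X ⨿ A) (f : Y ⇒ F₀ H Y ⨿ A) (h : X ⇒ Y) →
          f ∘ h ≈ (F₁ H h +₁ id) ∘ d → d * ≈ f * ∘ h
        compositionality :
          (d : X ⇒ F₀ H X ⨿ Y) (f : Y ⇒ F₀ H Y ⨿ A) →
          ((id +₁ f *) ∘ d) *
            ≈ (([ F₁ H inl , F₁ H inr ] +₁ id) ∘ assocˡ ∘ (id +₁ f) ∘ [ d , inr ]) * ∘ inl

  module Free (H : Endofunctor) (T : Iteratable H) where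

    T₀ : Obj → Obj
    T₀ X = FinalCoalgebra.carrier (T X)

    α : ∀ X → T₀ X ⇒ F₀ H (T₀ X) ⨿ X
    α X = FinalCoalgebra.structure (T X)

    private
      final : (c : Y ⇒ F₀ H Y ⨿ X) → ∃! _≈_ λ h → α X ∘ h ≈ (F₁ H h +₁ id) ∘ c
      final {X = X} = FinalCoalgebra.final (T X)

      final-unique : {c : Y ⇒ F₀ H Y ⨿ X} {g h : Y ⇒ T₀ X} →
        α X ∘ g ≈ (F₁ H g +₁ id) ∘ c → α X ∘ h ≈ (F₁ H h +₁ id) ∘ c → g ≈ h
      final-unique {c = c} p q = ≈-sym (proj₂ (proj₂ (final c)) p) ∙ proj₂ (proj₂ (final c)) q

    -- the inverse of α, by Lambek's lemma
    α⁻¹ : ∀ X → F₀ H (T₀ X) ⨿ X ⇒ T₀ X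
    α⁻¹ X = proj₁ (final (F₁ H (α X) +₁ id))

    α⁻¹∘α : α⁻¹ X ∘ α X ≈ id
    α⁻¹∘α {X} = final-unique
      (≈-sym assoc ∙ ∘-congˡ (proj₁ (proj₂ (final (F₁ H (α X) +₁ id)))) ∙
       ∘-congˡ (≈-sym (homomorphism (H ⊕ const X))))
      (identityʳ ∙ ≈-sym identityˡ ∙ ∘-congˡ (≈-sym (identity (H ⊕ const X))))

    α∘α⁻¹ : α X ∘ α⁻¹ X ≈ id
    α∘α⁻¹ {X} = proj₁ (proj₂ (final (F₁ H (α X) +₁ id)))
      ∙ ≈-sym (homomorphism (H ⊕ const X))
      ∙ F-resp-≈ (H ⊕ const X) α⁻¹∘α
      ∙ identity (H ⊕ const X)

    τ : ∀ X → F₀ H (T₀ X) ⇒ T₀ X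
    τ X = α⁻¹ X ∘ inl

    η : ∀ X → X ⇒ T₀ X
    η X = α⁻¹ X ∘ inr

    α∘τ : α X ∘ τ X ≈ inl
    α∘τ = ≈-sym assoc ∙ ∘-congˡ α∘α⁻¹ ∙ identityˡ

    α∘η : α X ∘ η X ≈ inr
    α∘η = ≈-sym assoc ∙ ∘-congˡ α∘α⁻¹ ∙ identityˡ

    [τ,η]∘α : {f : F₀ H (T₀ X) ⇒ Y} {g : X ⇒ Y} {s : T₀ X ⇒ Y} →
      s ∘ τ X ≈ f → s ∘ η X ≈ g → s ≈ [ f , g ] ∘ α X
    [τ,η]∘α p q = ≈-sym identityʳ ∙ ∘-congʳ (≈-sym α⁻¹∘α) ∙ ≈-sym assoc
      ∙ ∘-congˡ (≈-sym (unique (assoc ∙ p) (assoc ∙ q)))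

    fromα : {f : F₀ H (T₀ X) ⇒ Y} {g : X ⇒ Y} {s : T₀ X ⇒ Y} →
      s ≈ [ f , g ] ∘ α X → s ∘ τ X ≈ f × s ∘ η X ≈ g
    fromα p = (∘-congˡ p ∙ assoc ∙ ∘-congʳ α∘τ ∙ inject₁) , (∘-congˡ p ∙ assoc ∙ ∘-congʳ α∘η ∙ inject₂)

    -- T₁ f extends η ∘ f, and μ extends id.
    IsExtension : X ⇒ T₀ Y → T₀ X ⇒ T₀ Y → Set e
    IsExtension {X} {Y} f s = s ∘ τ X ≈ τ Y ∘ F₁ H s × s ∘ η X ≈ f

    extension : (f : X ⇒ T₀ Y) → ∃! _≈_ (IsExtension f)
    extension {X} {Y} f = s , fromα s≈ , λ p → unique-s p
      where
      c : T₀ X ⨿ T₀ Y ⇒ F₀ H (T₀ X ⨿ T₀ Y) ⨿ Y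
      c = [ [ inl ∘ F₁ H inl , (F₁ H inr +₁ id) ∘ α Y ∘ f ] ∘ α X , (F₁ H inr +₁ id) ∘ α Y ]

      step : {h : T₀ X ⨿ T₀ Y ⇒ T₀ Y} →
        (F₁ H h +₁ id) ∘ (F₁ H inr +₁ id) ∘ α Y ≈ (F₁ H (h ∘ inr) +₁ id) ∘ α Y
      step = pullˡ (≈-sym (homomorphism (H ⊕ const Y)))

      h = proj₁ (final c)
      h-eq = proj₁ (proj₂ (final c))

      h-inr : h ∘ inr ≈ id
      h-inr = final-unique {c = α Y}
        (≈-sym assoc ∙ ∘-congˡ h-eq ∙ assoc ∙ ∘-congʳ inject₂ ∙ step)
        (identityʳ ∙ ≈-sym identityˡ ∙ ∘-congˡ (≈-sym (identity (H ⊕ const Y))))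

      absorb : {k : T₀ X ⨿ T₀ Y ⇒ T₀ Y} → k ∘ inr ≈ id →
        (F₁ H k +₁ id) ∘ c ∘ inl ≈ α Y ∘ [ τ Y ∘ F₁ H (k ∘ inl) , f ] ∘ α X
      absorb {k} k-inr = begin
        (F₁ H k +₁ id) ∘ c ∘ inl
          ≈⟨ ∘-congʳ inject₁ ⟩
        (F₁ H k +₁ id) ∘ [ inl ∘ F₁ H inl , (F₁ H inr +₁ id) ∘ α Y ∘ f ] ∘ α X
          ≈⟨ pullˡ (≈-sym ∘-[]) ⟩
        [ (F₁ H k +₁ id) ∘ inl ∘ F₁ H inl , (F₁ H k +₁ id) ∘ (F₁ H inr +₁ id) ∘ α Y ∘ f ] ∘ α X
          ≈⟨ ∘-congˡ ([]-cong
               (pullˡ inject₁ ∙ assoc ∙ ∘-congʳ (≈-sym (homomorphism H)) ∙ ∘-congˡ (≈-sym α∘τ) ∙ assoc)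
               (∘-congʳ (≈-sym assoc) ∙ pullˡ step
                ∙ ∘-congˡ (∘-congˡ (F-resp-≈ (H ⊕ const Y) k-inr ∙ identity (H ⊕ const Y)) ∙ identityˡ))) ⟩
        [ α Y ∘ τ Y ∘ F₁ H (k ∘ inl) , α Y ∘ f ] ∘ α X
          ≈⟨ pushˡ ∘-[] ⟩
        α Y ∘ [ τ Y ∘ F₁ H (k ∘ inl) , f ] ∘ α X ∎

      s : T₀ X ⇒ T₀ Y
      s = h ∘ inl

      cancel : {g g′ : Z ⇒ T₀ Y} → α Y ∘ g ≈ α Y ∘ g′ → g ≈ g′
      cancel p = ≈-sym identityˡ ∙ ∘-congˡ (≈-sym α⁻¹∘α) ∙ assoc ∙ ∘-congʳ p
        ∙ ≈-sym assoc ∙ ∘-congˡ α⁻¹∘α ∙ identityˡ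

      s≈ : s ≈ [ τ Y ∘ F₁ H s , f ] ∘ α X
      s≈ = cancel (≈-sym assoc ∙ ∘-congˡ h-eq ∙ assoc ∙ absorb h-inr)

      unique-s : ∀ {s′} → IsExtension f s′ → s ≈ s′
      unique-s {s′} (p , q) = ∘-congˡ (proj₂ (proj₂ (final c)) k-eq) ∙ inject₁
        where
        k : T₀ X ⨿ T₀ Y ⇒ T₀ Y
        k = [ s′ , id ]
        k-eq : α Y ∘ k ≈ (F₁ H k +₁ id) ∘ c
        k-eq = +-ext
          (assoc ∙ ∘-congʳ (inject₁ ∙ [τ,η]∘α p q
             ∙ ∘-congˡ ([]-cong (∘-congʳ (F-resp-≈ H (≈-sym inject₁))) ≈-refl))
           ∙ ≈-sym (absorb inject₂) ∙ ≈-sym assoc)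
          (assoc ∙ ∘-congʳ inject₂ ∙ identityʳ ∙ ≈-sym identityˡ
           ∙ ∘-congˡ (≈-sym (F-resp-≈ (H ⊕ const Y) inject₂ ∙ identity (H ⊕ const Y)))
           ∙ ≈-sym step ∙ ∘-congʳ (≈-sym inject₂) ∙ ≈-sym assoc)

    extend : X ⇒ T₀ Y → T₀ X ⇒ T₀ Y
    extend f = proj₁ (extension f)

    extend-τ : {f : X ⇒ T₀ Y} → extend f ∘ τ X ≈ τ Y ∘ F₁ H (extend f)
    extend-τ {f = f} = proj₁ (proj₁ (proj₂ (extension f)))

    extend-η : {f : X ⇒ T₀ Y} → extend f ∘ η X ≈ f
    extend-η {f = f} = proj₂ (proj₁ (proj₂ (extension f)))

    -- s is a homomorphism of the H-algebras τ
    Isτ : (T₀ X ⇒ T₀ Y) → Set e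
    Isτ {X} {Y} s = s ∘ τ X ≈ τ Y ∘ F₁ H s

    Isτ-∘ : {s : T₀ Y ⇒ T₀ Z} {t : T₀ X ⇒ T₀ Y} → Isτ s → Isτ t → Isτ (s ∘ t)
    Isτ-∘ p q = assoc ∙ ∘-congʳ q ∙ extendʳ p ∙ ∘-congʳ (≈-sym (homomorphism H))

    Isτ-id : Isτ (id {T₀ X})
    Isτ-id = identityˡ ∙ ≈-sym identityʳ ∙ ∘-congʳ (≈-sym (identity H))

    Isτ-unique : {s t : T₀ X ⇒ T₀ Y} → Isτ s → Isτ t → s ∘ η X ≈ t ∘ η X → s ≈ t
    Isτ-unique {s = s} {t} p q r =
      ≈-sym (proj₂ (proj₂ (extension (t ∘ η _))) (p , r)) ∙ proj₂ (proj₂ (extension (t ∘ η _))) (q , ≈-refl)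

    T₁ : X ⇒ Y → T₀ X ⇒ T₀ Y
    T₁ f = proj₁ (extension (η _ ∘ f))

    TF : Endofunctor
    TF = record
      { F₀           = T₀
      ; F₁           = T₁
      ; identity     = Isτ-unique extend-τ Isτ-id (extend-η ∙ identityʳ ∙ ≈-sym identityˡ)
      ; homomorphism = Isτ-unique extend-τ (Isτ-∘ extend-τ extend-τ)
          (extend-η ∙ ≈-sym assoc ∙ ≈-sym (assoc ∙ ∘-congʳ extend-η ∙ pullˡ extend-η))
      ; F-resp-≈     = λ p → Isτ-unique extend-τ extend-τ (extend-η ∙ ∘-congʳ p ∙ ≈-sym extend-η)
      }

    μ : ∀ X → T₀ (T₀ X) ⇒ T₀ X
    μ X = proj₁ (extension id)

    κ : ∀ X → F₀ H X ⇒ T₀ X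
    κ X = τ X ∘ F₁ H (η X)

    record MonadMorphism : Set (o ⊔ ℓ ⊔ e) where
      field
        transformation : NatTrans TF TF
        unit           : ∀ X → transformation at X ∘ η X ≈ η X
        multiplication : ∀ X → transformation at X ∘ μ X
                             ≈ μ X ∘ T₁ (transformation at X) ∘ transformation at T₀ X

    open MonadMorphism public using (transformation)

    _≈ᵐ_ : MonadMorphism → MonadMorphism → Set (o ⊔ e)
    m ≈ᵐ n = ∀ X → transformation m at X ≈ transformation n at X

    μη : μ X ∘ η (T₀ X) ≈ id
    μη = extend-η

    T₁η : {f : X ⇒ Y} → T₁ f ∘ η X ≈ η Y ∘ f
    T₁η = extend-η

    μ-natural : {f : X ⇒ Y} → μ Y ∘ T₁ (T₁ f) ≈ T₁ f ∘ μ X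
    μ-natural = Isτ-unique (Isτ-∘ extend-τ extend-τ) (Isτ-∘ extend-τ extend-τ)
      (assoc ∙ ∘-congʳ T₁η ∙ pullˡ μη ∙ identityˡ ∙ ≈-sym identityʳ ∙ ∘-congʳ (≈-sym μη) ∙ ≈-sym assoc)

    μ-assoc : μ X ∘ μ (T₀ X) ≈ μ X ∘ T₁ (μ X)
    μ-assoc = Isτ-unique (Isτ-∘ extend-τ extend-τ) (Isτ-∘ extend-τ extend-τ)
      (assoc ∙ ∘-congʳ μη ∙ identityʳ ∙ ≈-sym identityˡ ∙ ∘-congˡ (≈-sym μη) ∙ assoc ∙ ∘-congʳ (≈-sym T₁η) ∙ ≈-sym assoc)

    μ-Tη : μ X ∘ T₁ (η X) ≈ id
    μ-Tη = Isτ-unique (Isτ-∘ extend-τ extend-τ) Isτ-id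
      (assoc ∙ ∘-congʳ T₁η ∙ pullˡ μη)

    μκ : μ X ∘ κ (T₀ X) ≈ τ X
    μκ = pullˡ extend-τ ∙ assoc ∙ ∘-congʳ (≈-sym (homomorphism H) ∙ F-resp-≈ H μη ∙ identity H) ∙ identityʳ

    κ-natural : (f : X ⇒ Y) → κ Y ∘ F₁ H f ≈ T₁ f ∘ κ X
    κ-natural f = assoc ∙ ∘-congʳ (≈-sym (homomorphism H) ∙ F-resp-≈ H (≈-sym T₁η) ∙ homomorphism H)
      ∙ extendʳ (≈-sym extend-τ)

    -- If every flat equation morphism X → H X + A for which some morphism X → A exists
    -- has a unique solution in A, then natural transformations H → T(H) extend to T(H).
    module Extend
      (solve : ∀ {X A} (a : F₀ H A ⇒ A) (d : X ⇒ F₀ H X ⨿ A) → X ⇒ A → ∃! _≈_ (IsSolution H a d))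
      (σ : NatTrans H TF) where

      private
        b : ∀ X → F₀ H (T₀ X) ⇒ T₀ X
        b X = μ X ∘ σ at T₀ X

        IsRec : X ⇒ T₀ Y → T₀ X ⇒ T₀ Y → Set e
        IsRec {X} {Y} f s = s ∘ τ X ≈ b Y ∘ F₁ H s × s ∘ η X ≈ f

        d : X ⇒ T₀ Y → T₀ X ⇒ F₀ H (T₀ X) ⨿ T₀ Y
        d {X} f = (id +₁ f) ∘ α X

        rhs : {f : X ⇒ T₀ Y} {s : T₀ X ⇒ T₀ Y} →
          [ b Y , id ] ∘ (F₁ H s +₁ id) ∘ d f ≈ [ b Y ∘ F₁ H s , f ] ∘ α X
        rhs = ∘-congʳ (pullˡ (+₁-∘ ∙ +₁-cong identityʳ identityˡ)) ∙ pullˡ ([]∘+₁ ∙ []-cong ≈-refl identityˡ)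

        Rec-unique : {f : X ⇒ T₀ Y} {s t : T₀ X ⇒ T₀ Y} → IsRec f s → IsRec f t → s ≈ t
        Rec-unique {Y = Y} {f} {s} (p , q) (p′ , q′) =
          ≈-sym (proj₂ (proj₂ sol) ([τ,η]∘α p q ∙ ≈-sym rhs)) ∙ proj₂ (proj₂ sol) ([τ,η]∘α p′ q′ ∙ ≈-sym rhs)
          where sol = solve (b Y) (d f) s

        ê : ∀ X → T₀ X ⇒ T₀ X
        ê X = proj₁ (solve (b X) (d (η X)) id)

        ê-rec : ∀ X → IsRec (η X) (ê X)
        ê-rec X = fromα (proj₁ (proj₂ (solve (b X) (d (η X)) id)) ∙ rhs)

        b-T₁ : (f : X ⇒ Y) → b Y ∘ F₁ H (T₁ f) ≈ T₁ f ∘ b X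
        b-T₁ f = assoc ∙ ∘-congʳ (natural σ (T₁ f)) ∙ extendʳ μ-natural

        ê-natural : (f : X ⇒ Y) → ê Y ∘ T₁ f ≈ T₁ f ∘ ê X
        ê-natural {X} {Y} f = Rec-unique
          ( (begin
              (ê Y ∘ T₁ f) ∘ τ X               ≈⟨ assoc ∙ ∘-congʳ extend-τ ⟩
              ê Y ∘ τ Y ∘ F₁ H (T₁ f)          ≈⟨ pullˡ (proj₁ (ê-rec Y)) ⟩
              (b Y ∘ F₁ H (ê Y)) ∘ F₁ H (T₁ f) ≈⟨ assoc ∙ ∘-congʳ (≈-sym (homomorphism H)) ⟩
              b Y ∘ F₁ H (ê Y ∘ T₁ f)          ∎)
          , assoc ∙ ∘-congʳ T₁η ∙ pullˡ (proj₂ (ê-rec Y)))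
          ( (begin
              (T₁ f ∘ ê X) ∘ τ X               ≈⟨ assoc ∙ ∘-congʳ (proj₁ (ê-rec X)) ⟩
              T₁ f ∘ b X ∘ F₁ H (ê X)          ≈⟨ pullˡ (≈-sym (b-T₁ f)) ⟩
              (b Y ∘ F₁ H (T₁ f)) ∘ F₁ H (ê X) ≈⟨ assoc ∙ ∘-congʳ (≈-sym (homomorphism H)) ⟩
              b Y ∘ F₁ H (T₁ f ∘ ê X)          ∎)
          , assoc ∙ ∘-congʳ (proj₂ (ê-rec X)) ∙ T₁η)

        b-μ : b X ∘ F₁ H (μ X) ≈ μ X ∘ b (T₀ X)
        b-μ {X} = begin
          (μ X ∘ σ at T₀ X) ∘ F₁ H (μ X)       ≈⟨ assoc ∙ ∘-congʳ (natural σ (μ X)) ⟩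
          μ X ∘ T₁ (μ X) ∘ σ at T₀ (T₀ X)      ≈⟨ extendʳ (≈-sym μ-assoc) ⟩
          μ X ∘ μ (T₀ X) ∘ σ at T₀ (T₀ X)      ∎

        ê-μ : ∀ X → ê X ∘ μ X ≈ μ X ∘ T₁ (ê X) ∘ ê (T₀ X)
        ê-μ X = Rec-unique
          ( (begin
              (ê X ∘ μ X) ∘ τ (T₀ X)          ≈⟨ assoc ∙ ∘-congʳ extend-τ ⟩
              ê X ∘ τ X ∘ F₁ H (μ X)          ≈⟨ pullˡ (proj₁ (ê-rec X)) ⟩
              (b X ∘ F₁ H (ê X)) ∘ F₁ H (μ X) ≈⟨ assoc ∙ ∘-congʳ (≈-sym (homomorphism H)) ⟩
              b X ∘ F₁ H (ê X ∘ μ X)          ∎)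
          , assoc ∙ ∘-congʳ μη ∙ identityʳ)
          ( (begin
              (μ X ∘ T₁ (ê X) ∘ ê (T₀ X)) ∘ τ (T₀ X)
                ≈⟨ assoc ∙ ∘-congʳ (assoc ∙ ∘-congʳ (proj₁ (ê-rec (T₀ X)))) ⟩
              μ X ∘ T₁ (ê X) ∘ b (T₀ X) ∘ F₁ H (ê (T₀ X))
                ≈⟨ ∘-congʳ (extendʳ (≈-sym (b-T₁ (ê X)))) ⟩
              μ X ∘ b (T₀ X) ∘ F₁ H (T₁ (ê X)) ∘ F₁ H (ê (T₀ X))
                ≈⟨ extendʳ (≈-sym b-μ) ⟩
              b X ∘ F₁ H (μ X) ∘ F₁ H (T₁ (ê X)) ∘ F₁ H (ê (T₀ X))
                ≈⟨ ∘-congʳ (∘-congʳ (≈-sym (homomorphism H)) ∙ ≈-sym (homomorphism H)) ⟩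
              b X ∘ F₁ H (μ X ∘ T₁ (ê X) ∘ ê (T₀ X)) ∎)
          , (assoc ∙ ∘-congʳ (assoc ∙ ∘-congʳ (proj₂ (ê-rec (T₀ X))) ∙ T₁η) ∙ pullˡ μη ∙ identityˡ))

      monadExtension : ∃! _≈ᵐ_ λ m → ∀ X → transformation m at X ∘ κ X ≈ σ at X
      monadExtension = m , m-κ , λ {n} n-κ X → Rec-unique (ê-rec X) (n-rec n n-κ X)
        where
        m : MonadMorphism
        m = record
          { transformation = record { component = ê ; natural = ê-natural }
          ; unit           = λ X → proj₂ (ê-rec X)
          ; multiplication = ê-μ
          }

        m-κ : ∀ X → ê X ∘ κ X ≈ σ at X
        m-κ X = begin
          ê X ∘ τ X ∘ F₁ H (η X)              ≈⟨ pullˡ (proj₁ (ê-rec X)) ⟩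
          (b X ∘ F₁ H (ê X)) ∘ F₁ H (η X)     ≈⟨ assoc ∙ ∘-congʳ (≈-sym (homomorphism H) ∙ F-resp-≈ H (proj₂ (ê-rec X))) ⟩
          b X ∘ F₁ H (η X)                    ≈⟨ assoc ∙ ∘-congʳ (natural σ (η X)) ⟩
          μ X ∘ T₁ (η X) ∘ σ at X             ≈⟨ pullˡ μ-Tη ∙ identityˡ ⟩
          σ at X                              ∎

        n-rec : ∀ n → (∀ X → transformation n at X ∘ κ X ≈ σ at X) → ∀ X → IsRec (η X) (transformation n at X)
        n-rec n n-κ X = (begin
            nX ∘ τ X                                        ≈⟨ ∘-congʳ (≈-sym μκ) ⟩
            nX ∘ μ X ∘ κ (T₀ X)                             ≈⟨ pullˡ (MonadMorphism.multiplication n X) ⟩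
            (μ X ∘ T₁ nX ∘ transformation n at T₀ X) ∘ κ (T₀ X) ≈⟨ assoc ∙ ∘-congʳ (assoc ∙ ∘-congʳ (n-κ (T₀ X))) ⟩
            μ X ∘ T₁ nX ∘ σ at T₀ X                         ≈⟨ ∘-congʳ (≈-sym (natural σ nX)) ∙ ≈-sym assoc ⟩
            b X ∘ F₁ H nX                                   ∎)
          , MonadMorphism.unit n X
          where nX = transformation n at X

  module Schemes (H V : Endofunctor) (T : Iteratable (H ⊕ V)) where
    open Free (H ⊕ V) T

    RecursiveProgramScheme : Set (o ⊔ ℓ ⊔ e)
    RecursiveProgramScheme = NatTrans V TF

    Guarded : RecursiveProgramScheme → Set (o ⊔ ℓ ⊔ e)
    Guarded s = Σ (NatTrans V (H ∘F TF)) λ f → ∀ X → s at X ≈ τ X ∘ inl ∘ f at X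

    [κinl,_] : RecursiveProgramScheme → NatTrans (H ⊕ V) TF
    [κinl, s ] = record
      { component = λ X → [ κ X ∘ inl , s at X ]
      ; natural   = λ f → []∘+₁ ∙ []-cong
          (assoc ∙ ∘-congʳ (≈-sym inject₁) ∙ extendʳ (κ-natural f) ) (natural s f) ∙ ∘-[]
      }

record NonExpanding (X Y : Space) : Set where
  field
    fun          : ∣ X ∣ → ∣ Y ∣
    nonexpanding : ∀ x x′ → Space.d Y (fun x) (fun x′) ≤ Space.d X x x′

  fun-cong : ∀ {x x′} → Space._≈_ X x x′ → Space._≈_ Y (fun x) (fun x′)
  fun-cong {x} {x′} x≈x′ = Space.≼⇒≈ Y (nonexpanding x x′ 0ℚ (Space.≈⇒≼ X x≈x′))

open NonExpanding public

record _≗_ {X Y : Space} (f g : NonExpanding X Y) : Set where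
  constructor pointwise
  field pt : ∀ x → Space._≈_ Y (fun f x) (fun g x)

open _≗_ public

CMS : Category (lsuc 0ℓ) 0ℓ 0ℓ
CMS = record
  { Obj       = Space
  ; _⇒_       = NonExpanding
  ; _≈_       = _≗_
  ; equiv     = λ {_} {Y} → record
    { refl  = pointwise λ _ → Space.≈-refl Y
    ; sym   = λ p → pointwise λ x → Space.≈-sym Y (pt p x)
    ; trans = λ p q → pointwise λ x → Space.≈-trans Y (pt p x) (pt q x)
    }
  ; id        = record { fun = λ x → x ; nonexpanding = λ _ _ _ h → h }
  ; _∘_       = λ g f → record
    { fun          = λ x → fun g (fun f x)
    ; nonexpanding = λ x x′ q h → nonexpanding g _ _ q (nonexpanding f x x′ q h)
    }
  ; ∘-resp-≈  = λ {_} {_} {Z} {f} {_} {_} {g′} p q → pointwise λ x →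
      Space.≈-trans Z (fun-cong f (pt q x)) (pt p (fun g′ x))
  ; assoc     = λ {_} {_} {_} {Y} → pointwise λ _ → Space.≈-refl Y
  ; identityˡ = λ {_} {Y} → pointwise λ _ → Space.≈-refl Y
  ; identityʳ = λ {_} {Y} → pointwise λ _ → Space.≈-refl Y
  }

private
  1≰½ : ¬ (1ℚ ℚ.≤ ½)
  1≰½ h = ℚ.<-irrefl refl (ℚ.<-≤-trans (ℚ.*<* (ℤ.+<+ (ℕ.s≤s (ℕ.s≤s ℕ.z≤n)))) h)

module Sum (X Y : Space) where
  private
    module X = Space X
    module Y = Space Y

  dist⊎ : X.∣_∣ ⊎ Y.∣_∣ → X.∣_∣ ⊎ Y.∣_∣ → ℝ⁺
  dist⊎ (inj₁ x) (inj₁ x′) = X.d x x′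
  dist⊎ (inj₂ y) (inj₂ y′) = Y.d y y′
  dist⊎ (inj₁ _) (inj₂ _)  = 1ℝ
  dist⊎ (inj₂ _) (inj₁ _)  = 1ℝ

  private
    refl⊎ : ∀ z → dist⊎ z z ≼ 0ℚ
    refl⊎ (inj₁ x) = X.≈⇒≼ X.≈-refl
    refl⊎ (inj₂ y) = Y.≈⇒≼ Y.≈-refl

    sym⊎ : ∀ z w {q} → dist⊎ z w ≼ q → dist⊎ w z ≼ q
    sym⊎ (inj₁ _) (inj₁ _) = X.d-sym
    sym⊎ (inj₁ _) (inj₂ _) h = h
    sym⊎ (inj₂ _) (inj₁ _) h = h
    sym⊎ (inj₂ _) (inj₂ _) = Y.d-sym

    d⊎≼1 : ∀ z w → dist⊎ z w ≼ 1ℚ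
    d⊎≼1 (inj₁ _) (inj₁ _) = X.d≼1
    d⊎≼1 (inj₁ _) (inj₂ _) = ℚ.≤-refl
    d⊎≼1 (inj₂ _) (inj₁ _) = ℚ.≤-refl
    d⊎≼1 (inj₂ _) (inj₂ _) = Y.d≼1

    ≤+ : ∀ {p q} → 1ℚ ℚ.≤ p → 0ℚ ℚ.≤ q → 1ℚ ℚ.≤ p ℚ.+ q
    ≤+ = ℚ.+-mono-≤

    ≤+ʳ : ∀ {p q} → 0ℚ ℚ.≤ p → 1ℚ ℚ.≤ q → 1ℚ ℚ.≤ p ℚ.+ q
    ≤+ʳ = ℚ.+-mono-≤

    1≤⇒0≤ : ∀ {q} → 1ℚ ℚ.≤ q → 0ℚ ℚ.≤ q
    1≤⇒0≤ = nonneg 1ℝ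

    tri⊎ : ∀ z w v {p q} → dist⊎ z w ≼ p → dist⊎ w v ≼ q → dist⊎ z v ≼ p ℚ.+ q
    tri⊎ (inj₁ _) (inj₁ _) (inj₁ _) h k = X.triangle h k
    tri⊎ (inj₁ x) (inj₁ w) (inj₂ _) h k = ≤+ʳ (nonneg (X.d x w) h) k
    tri⊎ (inj₁ _) (inj₂ w) (inj₂ v) h k = ≤+ h (nonneg (Y.d w v) k)
    tri⊎ (inj₁ x) (inj₂ _) (inj₁ v) h k = upper (X.d x v) (≤+ h (1≤⇒0≤ k)) X.d≼1
    tri⊎ (inj₂ x) (inj₁ _) (inj₂ v) h k = upper (Y.d x v) (≤+ h (1≤⇒0≤ k)) Y.d≼1
    tri⊎ (inj₂ _) (inj₁ w) (inj₁ v) h k = ≤+ h (nonneg (X.d w v) k)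
    tri⊎ (inj₂ x) (inj₂ w) (inj₁ _) h k = ≤+ʳ (nonneg (Y.d x w) h) k
    tri⊎ (inj₂ _) (inj₂ _) (inj₂ _) h k = Y.triangle h k

    -- replaces the components of s in the other summand by a default value
    left : X.∣_∣ → X.∣_∣ ⊎ Y.∣_∣ → X.∣_∣
    left x₀ (inj₁ x) = x
    left x₀ (inj₂ _) = x₀

    right : Y.∣_∣ → X.∣_∣ ⊎ Y.∣_∣ → Y.∣_∣
    right y₀ (inj₂ y) = y
    right y₀ (inj₁ _) = y₀

    left-dist : ∀ x₀ z w {q} → dist⊎ z w ≼ q → X.d (left x₀ z) (left x₀ w) ≼ q
    left-dist x₀ (inj₁ x) (inj₁ x′) h = h
    left-dist x₀ (inj₁ x) (inj₂ _)  h = upper (X.d x x₀) h X.d≼1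
    left-dist x₀ (inj₂ _) (inj₁ x)  h = upper (X.d x₀ x) h X.d≼1
    left-dist x₀ (inj₂ y) (inj₂ y′) h = upper (X.d x₀ x₀) (nonneg (Y.d y y′) h) (X.≈⇒≼ X.≈-refl)

    right-dist : ∀ y₀ z w {q} → dist⊎ z w ≼ q → Y.d (right y₀ z) (right y₀ w) ≼ q
    right-dist y₀ (inj₂ y) (inj₂ y′) h = h
    right-dist y₀ (inj₂ y) (inj₁ _)  h = upper (Y.d y y₀) h Y.d≼1
    right-dist y₀ (inj₁ _) (inj₂ y)  h = upper (Y.d y₀ y) h Y.d≼1
    right-dist y₀ (inj₁ x) (inj₁ x′) h = upper (Y.d y₀ y₀) (nonneg (X.d x x′) h) (Y.≈⇒≼ Y.≈-refl)

    back₁ : ∀ x₀ z l {q} → dist⊎ z (inj₁ x₀) ≼ ½ → X.d (left x₀ z) l ≼ q → dist⊎ z (inj₁ l) ≼ q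
    back₁ x₀ (inj₁ x) l _ k = k
    back₁ x₀ (inj₂ _) l h k = ⊥-elim (1≰½ h)

    back₂ : ∀ y₀ z l {q} → dist⊎ z (inj₂ y₀) ≼ ½ → Y.d (right y₀ z) l ≼ q → dist⊎ z (inj₂ l) ≼ q
    back₂ y₀ (inj₂ y) l _ k = k
    back₂ y₀ (inj₁ _) l h k = ⊥-elim (1≰½ h)

    complete⊎ : ∀ s → Cauchy dist⊎ s → ∃[ l ] _ConvergesTo_ dist⊎ s l
    complete⊎ s cauchy with cauchy ½ (ℚ.positive⁻¹ ½)
    ... | N , near with s N in eq
    ...   | inj₁ x₀ = inj₁ l , λ δ 0<δ → let M , h = conv δ 0<δ in N ℕ.⊔ M , λ n N⊔M≤n →
              back₁ x₀ (s n) l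
                (subst (λ z → dist⊎ (s n) z ≼ ½) eq (near n N (ℕ.≤-trans (ℕ.m≤m⊔n N M) N⊔M≤n) ℕ.≤-refl))
                (h n (ℕ.≤-trans (ℕ.m≤n⊔m N M) N⊔M≤n))
      where
      lim = X.complete (λ n → left x₀ (s n)) λ δ 0<δ → let M , h = cauchy δ 0<δ in
              M , λ m n p q → left-dist x₀ (s m) (s n) (h m n p q)
      l = proj₁ lim
      conv = proj₂ lim
    ...   | inj₂ y₀ = inj₂ l , λ δ 0<δ → let M , h = conv δ 0<δ in N ℕ.⊔ M , λ n N⊔M≤n →
              back₂ y₀ (s n) l
                (subst (λ z → dist⊎ (s n) z ≼ ½) eq (near n N (ℕ.≤-trans (ℕ.m≤m⊔n N M) N⊔M≤n) ℕ.≤-refl))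
                (h n (ℕ.≤-trans (ℕ.m≤n⊔m N M) N⊔M≤n))
      where
      lim = Y.complete (λ n → right y₀ (s n)) λ δ 0<δ → let M , h = cauchy δ 0<δ in
              M , λ m n p q → right-dist y₀ (s m) (s n) (h m n p q)
      l = proj₁ lim
      conv = proj₂ lim

  sumSpace : Space
  sumSpace = mkSpace (X.∣_∣ ⊎ Y.∣_∣) dist⊎ refl⊎ (λ {z} {w} → sym⊎ z w)
    (λ {z} {w} {v} → tri⊎ z w v) d⊎≼1 complete⊎

coproducts : Coproducts CMS
coproducts = record
  { _⨿_     = Sum.sumSpace
  ; inl     = record { fun = inj₁ ; nonexpanding = λ _ _ _ h → h }
  ; inr     = record { fun = inj₂ ; nonexpanding = λ _ _ _ h → h }
  ; [_,_]   = λ {A} {B} {X} f g → record { fun = copair f g ; nonexpanding = copair-nonexpanding f g }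
  ; inject₁ = λ {_} {_} {X} → pointwise λ _ → Space.≈-refl X
  ; inject₂ = λ {_} {_} {X} → pointwise λ _ → Space.≈-refl X
  ; unique  = λ {A} {B} {X} p q → pointwise λ
      { (inj₁ a) → Space.≈-sym X (pt p a)
      ; (inj₂ b) → Space.≈-sym X (pt q b) }
  }
  where
  module _ {A B X : Space} (f : NonExpanding A X) (g : NonExpanding B X) where
    copair : ∣ A ∣ ⊎ ∣ B ∣ → ∣ X ∣
    copair (inj₁ a) = fun f a
    copair (inj₂ b) = fun g b

    copair-nonexpanding : ∀ z w → Space.d X (copair z) (copair w) ≤ Sum.dist⊎ A B z w
    copair-nonexpanding (inj₁ a) (inj₁ a′) = nonexpanding f a a′
    copair-nonexpanding (inj₂ b) (inj₂ b′) = nonexpanding g b b′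
    copair-nonexpanding (inj₁ a) (inj₂ b) = Space.bounded X _ _
    copair-nonexpanding (inj₂ b) (inj₁ a) = Space.bounded X _ _

open Category CMS public using (_⇒_; _≈_; _∘_; id)
open Coproducts coproducts public using (_⨿_; inl; inr; [_,_])
open Iteration CMS coproducts public

private variable
  X Y : Space
  F G : Endofunctor

homDist : X ⇒ Y → X ⇒ Y → ℝ⁺
homDist {X} {Y} f g = sup λ x → Space.d Y (fun f x) (fun g x)

record Contracting (F : Endofunctor) : Set₁ where
  field
    ε        : ℝ⁺
    ε<1      : ε < 1ℝ
    contract : (f g : X ⇒ Y) → homDist (F₁ F f) (F₁ F g) ≤ ε * homDist f g

-- the same condition, with a rational factor
record ContractingBy (q : ℚ) (F : Endofunctor) : Set₁ where
  field
    0≤q      : 0ℚ ℚ.≤ q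
    q<1      : q ℚ.< 1ℚ
    contract : (f g : X ⇒ Y) → ∀ {p} → 0ℚ ℚ.≤ p → (∀ x → Space.d Y (fun f x) (fun g x) ≼ p) →
               ∀ u → Space.d (F₀ F Y) (fun (F₁ F f) u) (fun (F₁ F g) u) ≼ q ℚ.* p

rational : Contracting F → ∃[ q ] ContractingBy q F
rational record { ε = ε ; ε<1 = q , ε≼q , 1⋠q ; contract = h } = q , record
  { 0≤q      = nonneg ε ε≼q
  ; q<1      = ℚ.≰⇒> 1⋠q
  ; contract = λ f g {p} 0≤p f~g u → proj₂ (h f g (q ℚ.* p) λ r qp<r →
                 q , p , ε≼q , (0≤p , f~g) , ℚ.<⇒≤ qp<r) u
  }

contractingBy⇒contracting : ∀ {q} → ContractingBy q F → Contracting F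
contractingBy⇒contracting {F} {q} c = record
  { ε        = fromℚ q 0≤q
  ; ε<1      = q , ℚ.≤-refl , λ 1≤q → ℚ.<-irrefl refl (ℚ.<-≤-trans q<1 1≤q)
  ; contract = λ {X} {Y} f g r h → closed (homDist (F₁ F f) (F₁ F g)) λ s r<s →
      let a , b , q≤a , (0≤b , f~g) , ab≤s = h s r<s
          qb≤s = ℚ.≤-trans (*-mono 0≤q 0≤b q≤a ℚ.≤-refl) ab≤s
      in ℚ.≤-trans (*-nonneg 0≤q 0≤b) qb≤s ,
         λ u → upper (Space.d (F₀ F Y) (fun (F₁ F f) u) (fun (F₁ F g) u)) qb≤s (contract f g 0≤b f~g u)
  }
  where open ContractingBy c

⊕-contracting : Contracting F → Contracting G → Contracting (F ⊕ G)
⊕-contracting {F} {G} cF cG = contractingBy⇒contracting {q = r} record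
    { 0≤q = ℚ.≤-trans F.0≤q p≤r
    ; q<1 = r<1
    ; contract = contract⊕
    }
  where
  p = proj₁ (rational cF)
  q = proj₁ (rational cG)
  module F = ContractingBy (proj₂ (rational cF))
  module G = ContractingBy (proj₂ (rational cG))
  r = p ℚ.⊔ q
  p≤r : p ℚ.≤ r
  p≤r = ℚ.p≤p⊔q p q
  q≤r : q ℚ.≤ r
  q≤r = ℚ.p≤q⊔p p q
  r<1 : r ℚ.< 1ℚ
  r<1 with ℚ.⊔-sel p q
  ... | inj₁ eq = subst (ℚ._< 1ℚ) (≡.sym eq) F.q<1
  ... | inj₂ eq = subst (ℚ._< 1ℚ) (≡.sym eq) G.q<1
  contract⊕ : (f g : X ⇒ Y) → ∀ {b} → 0ℚ ℚ.≤ b → (∀ x → Space.d Y (fun f x) (fun g x) ≼ b) →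
              ∀ u → Space.d (F₀ (F ⊕ G) Y) (fun (F₁ (F ⊕ G) f) u) (fun (F₁ (F ⊕ G) g) u) ≼ r ℚ.* b
  contract⊕ {Y = Y} f g 0≤b f~g (inj₁ u) = upper (Space.d (F₀ F Y) (fun (F₁ F f) u) (fun (F₁ F g) u))
    (*-mono F.0≤q 0≤b p≤r ℚ.≤-refl) (F.contract f g 0≤b f~g u)
  contract⊕ {Y = Y} f g 0≤b f~g (inj₂ u) = upper (Space.d (F₀ G Y) (fun (F₁ G f) u) (fun (F₁ G g) u))
    (*-mono G.0≤q 0≤b q≤r ℚ.≤-refl) (G.contract f g 0≤b f~g u)

const-contracting : ∀ X → Contracting (const X)
const-contracting X = contractingBy⇒contracting {q = 0ℚ} record
  { 0≤q = ℚ.≤-refl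
  ; q<1 = ℚ.positive⁻¹ 1ℚ
  ; contract = λ f g {p} 0≤p _ u → upper (Space.d X u u) (ℚ.≤-reflexive (≡.sym (ℚ.*-zeroˡ p)))
                 (Space.≈⇒≼ X (Space.≈-refl X))
  }

bound3 : ∀ (Z : Space) {x y z w p q} → Space.d Z x y ≼ p → Space.d Z y z ≼ q → Space.d Z z w ≼ p →
         Space.d Z x w ≼ q ℚ.+ (p ℚ.+ p)
bound3 Z {x} {w = w} {p} {q} h k l = subst (Space.d Z x w ≼_)
  (solve 2 (λ p q → p :+ q :+ p := q :+ (p :+ p)) refl p q)
  (Space.triangle Z (Space.triangle Z h k) l)
  where open +-*-Solver

-- Banach's fixed point theorem for the equation d, starting from s₀
module Banach {F : Endofunctor} (cF : Contracting F) {A X : Space}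
              (a : F₀ F A ⇒ A) (d : X ⇒ F₀ F X ⨿ A) (s₀ : X ⇒ A) where
  private
    q = proj₁ (rational cF)
    open ContractingBy (proj₂ (rational cF))
    open Powers q 0≤q q<1
    module A = Space A

    Φ : X ⇒ A → X ⇒ A
    Φ s = [ a , id ] ∘ (F₁ F s +₁ id) ∘ d

    Φ-contract : ∀ s t {p} → 0ℚ ℚ.≤ p → (∀ x → A.d (fun s x) (fun t x) ≼ p) →
                 ∀ x → A.d (fun (Φ s) x) (fun (Φ t) x) ≼ q ℚ.* p
    Φ-contract s t 0≤p s~t x with fun d x
    ... | inj₁ u = nonexpanding a _ _ _ (contract s t 0≤p s~t u)
    ... | inj₂ y = upper (A.d y y) (*-nonneg 0≤q 0≤p) (A.≈⇒≼ A.≈-refl)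

    s⟨_⟩ : ℕ → X ⇒ A
    s⟨ zero ⟩  = s₀
    s⟨ suc n ⟩ = Φ s⟨ n ⟩

    s-close : ∀ n k x → A.d (fun s⟨ n ⟩ x) (fun s⟨ n ℕ.+ k ⟩ x) ≼ q ^ n
    s-close zero    k x = A.d≼1
    s-close (suc n) k x = Φ-contract s⟨ n ⟩ s⟨ n ℕ.+ k ⟩ (^-nonneg n) (s-close n k) x

    lim : ∀ x → ∃[ l ] ∀ n → A.d (fun s⟨ n ⟩ x) l ≼ q ^ n
    lim x = A.limit 0≤q q<1 (λ n → fun s⟨ n ⟩ x) λ n k → s-close n k x

    s : X ⇒ A
    s = record
      { fun          = λ x → proj₁ (lim x)
      ; nonexpanding = λ x x′ p h → A.squeeze 0≤q q<1 λ n →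
          bound3 A (A.d-sym (proj₂ (lim x) n)) (nonexpanding s⟨ n ⟩ x x′ p h) (proj₂ (lim x′) n)
      }

    weaken : ∀ {x y} n → A.d x y ≼ q ^ suc n → A.d x y ≼ q ^ n
    weaken {x} {y} n = upper (A.d x y) (^-suc n)

    s-solution : s ≈ Φ s
    s-solution = pointwise λ x → A.≈-squeeze 0≤q q<1 λ n → A.triangle
      (A.d-sym (weaken n (proj₂ (lim x) (suc n))))
      (weaken n (Φ-contract s⟨ n ⟩ s (^-nonneg n) (λ x → proj₂ (lim x) n) x))

    unique′ : ∀ {s t} → s ≈ Φ s → t ≈ Φ t → ∀ n x → A.d (fun s x) (fun t x) ≼ q ^ n
    unique′ p r zero    x = A.d≼1
    unique′ {s} {t} p r (suc n) x = A.d-resp (pt p x) (pt r x) (Φ-contract s t (^-nonneg n) (unique′ {s} {t} p r n) x)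

  solution : ∃! _≈_ (IsSolution F a d)
  solution = s , s-solution , λ {t} t-solution → pointwise λ x → A.≈-squeeze 0≤q q<1 λ n →
    upper (A.d (fun s x) (fun t x))
      (ℚ.≤-trans (ℚ.≤-reflexive (≡.sym (ℚ.+-identityʳ _))) (ℚ.+-monoʳ-≤ (q ^ n) (^-nonneg n)))
      (unique′ {s} {t} s-solution t-solution n x)

cia : Contracting F → ∀ {A} (a : F₀ F A ⇒ A) → ∣ A ∣ → CIA F a
cia cF {A} a a₀ {X} d = Banach.solution cF a d record
  { fun          = λ _ → a₀
  ; nonexpanding = λ x x′ q h → upper (Space.d A a₀ a₀) (nonneg (Space.d X x x′) h) (Space.≈⇒≼ A (Space.≈-refl A))
  }

-- The final coalgebra is the limit L of the chain 1 ← F 1 ← F (F 1) ← …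
module Final {F : Endofunctor} (cF : Contracting F) where
  private
    q = proj₁ (rational cF)
    open ContractingBy (proj₂ (rational cF))
    open Powers q 0≤q q<1
    open Endofunctor F using (identity; homomorphism; F-resp-≈)

    point : Space
    point = mkSpace ⊤ (λ _ _ → 0ℝ) (λ _ → ℚ.≤-refl) (λ h → h) ℚ.+-mono-≤ (λ _ _ → ℚ.nonNegative⁻¹ 1ℚ)
      λ _ _ → tt , λ _ 0<δ → 0 , λ _ _ → ℚ.<⇒≤ 0<δ

    ! : X ⇒ point
    ! {X} = record { fun = λ _ → tt ; nonexpanding = λ x x′ _ → nonneg (Space.d X x x′) }

    chain : ℕ → Space
    chain zero    = point
    chain (suc n) = F₀ F (chain n)

    module Chain n = Space (chain n)

    P : ∀ m k → chain (m ℕ.+ k) ⇒ chain m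
    P zero    k = !
    P (suc m) k = F₁ F (P m k)

    Thread : (∀ n → ∣ chain n ∣) → Set
    Thread x = ∀ m k → Chain._≈_ m (fun (P m k) (x (m ℕ.+ k))) (x m)

    ∣L∣ : Set
    ∣L∣ = Σ (∀ n → ∣ chain n ∣) Thread

    dL : ∣L∣ → ∣L∣ → ℝ⁺
    dL (x , _) (y , _) = sup λ n → Chain.d n (x n) (y n)

    L-complete : ∀ s → Cauchy dL s → ∃[ l ] _ConvergesTo_ dL s l
    L-complete s cauchy = (l , l-thread) , conv
      where
      lim : ∀ n → ∃[ l ] _ConvergesTo_ (Chain.d n) (λ i → proj₁ (s i) n) l
      lim n = Chain.complete n (λ i → proj₁ (s i) n) λ δ 0<δ → let N , h = cauchy δ 0<δ in
        N , λ i j p r → proj₂ (h i j p r) n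

      l : ∀ n → ∣ chain n ∣
      l n = proj₁ (lim n)

      conv′ : ∀ δ → 0ℚ ℚ.< δ → ∃[ N ] ∀ i → N ℕ.≤ i → ∀ n → Chain.d n (proj₁ (s i) n) (l n) ≼ δ
      conv′ δ 0<δ = let N , h = cauchy δ 0<δ in
        N , λ i N≤i n → Chain.uniform n (proj₂ (lim n)) (λ j k p r → proj₂ (h j k p r) n) i N≤i

      l-thread : Thread l
      l-thread m k = Chain.≼⇒≈ m (closed (Chain.d m _ _) λ r 0<r →
        let δ , 0<δ , eq = half 0<r
            N , h = conv′ δ 0<δ
        in subst (Chain.d m (fun (P m k) (l (m ℕ.+ k))) (l m) ≼_) (≡.trans (≡.sym (ℚ.+-identityˡ _)) eq)
             (Chain.triangle m
               (Chain.d-resp m (Chain.≈-refl m) (Chain.≈-sym m (proj₂ (s N) m k))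
                 (nonexpanding (P m k) _ _ δ (Chain.d-sym (m ℕ.+ k) (h N ℕ.≤-refl (m ℕ.+ k)))))
               (h N ℕ.≤-refl m)))

      conv : _ConvergesTo_ dL s (l , l-thread)
      conv δ 0<δ = let N , h = conv′ δ 0<δ in N , λ i N≤i → ℚ.<⇒≤ 0<δ , h i N≤i

    L : Space
    L = mkSpace ∣L∣ dL
      (λ _ → ℚ.≤-refl , λ n → Chain.≈⇒≼ n (Chain.≈-refl n))
      (λ (0≤q , h) → 0≤q , λ n → Chain.d-sym n (h n))
      (λ (0≤p , h) (0≤q , k) → +-nonneg 0≤p 0≤q , λ n → Chain.triangle n (h n) (k n))
      (λ _ _ → ℚ.nonNegative⁻¹ 1ℚ , λ n → Chain.d≼1 n)
      L-complete

    module L = Space L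
    module FL = Space (F₀ F L)

    π : ∀ n → L ⇒ chain n
    π n = record { fun = λ x → proj₁ x n ; nonexpanding = λ _ _ _ h → proj₂ h n }

    P-π : ∀ m k → P m k ∘ π (m ℕ.+ k) ≈ π m
    P-π m k = pointwise λ x → proj₂ x m k

    φ-fun : ∣ F₀ F L ∣ → ∀ n → ∣ chain n ∣
    φ-fun u zero    = tt
    φ-fun u (suc n) = fun (F₁ F (π n)) u

    F-∘ : ∀ {X Y Z} {f : X ⇒ Y} {g : Y ⇒ Z} {h : X ⇒ Z} → g ∘ f ≈ h →
          ∀ u → Space._≈_ (F₀ F Z) (fun (F₁ F g) (fun (F₁ F f) u)) (fun (F₁ F h) u)
    F-∘ {Z = Z} p u = Space.≈-trans (F₀ F Z) (Space.≈-sym (F₀ F Z) (pt homomorphism u)) (pt (F-resp-≈ p) u)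

    φ : F₀ F L ⇒ L
    φ = record
      { fun          = λ u → φ-fun u , λ { zero k → ℚ.≤-refl ; (suc m) k → F-∘ (P-π m k) u }
      ; nonexpanding = λ u v q h → nonneg (FL.d u v) h , λ
          { zero    → nonneg (FL.d u v) h
          ; (suc n) → nonexpanding (F₁ F (π n)) u v q h }
      }

    constant : ∣L∣ → point ⇒ L
    constant x = record { fun = λ _ → x ; nonexpanding = λ _ _ _ 0≤q → upper (dL x x) 0≤q (L.≈⇒≼ {x} {x} (L.≈-refl {x})) }

    module Embed (x : ∣L∣) where
      j : ∀ n → chain n ⇒ L
      j zero    = constant x
      j (suc n) = φ ∘ F₁ F (j n)

      j-close : ∀ m k z → L.d (fun (j m ∘ P m k) z) (fun (j (m ℕ.+ k)) z) ≼ q ^ m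
      j-close zero    k z = L.d≼1 {fun (j zero ∘ P zero k) z} {fun (j k) z}
      j-close (suc m) k z = nonexpanding φ _ _ _
        (FL.d-resp (F-∘ {h = j m ∘ P m k} (pointwise λ z → L.≈-refl {fun (j m ∘ P m k) z}) z) FL.≈-refl
          (contract (j m ∘ P m k) (j (m ℕ.+ k)) (^-nonneg m) (j-close m k) z))

      π-j : ∀ m k → π m ∘ j (m ℕ.+ k) ≈ P m k
      π-j zero    k = pointwise λ _ → ℚ.≤-refl
      π-j (suc m) k = pointwise λ z → F-∘ (π-j m k) z

      z⟨_⟩ : ℕ → ∣ F₀ F L ∣
      z⟨ n ⟩ = fun (F₁ F (j n)) (proj₁ x (suc n))

      z-close : ∀ n k → FL.d z⟨ n ⟩ z⟨ n ℕ.+ k ⟩ ≼ q ^ n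
      z-close n k = upper (FL.d z⟨ n ⟩ z⟨ n ℕ.+ k ⟩) (^-suc n)
        (FL.d-resp
          (FL.≈-trans (fun-cong (F₁ F (j n)) (Chain.≈-sym (suc n) (proj₂ x (suc n) k)))
            (F-∘ {h = j n ∘ P n k} (pointwise λ z → L.≈-refl {fun (j n ∘ P n k) z}) (proj₁ x (suc n ℕ.+ k))))
          FL.≈-refl
          (contract (j n ∘ P n k) (j (n ℕ.+ k)) (^-nonneg n) (j-close n k) (proj₁ x (suc n ℕ.+ k))))

      lim : ∃[ l ] ∀ n → FL.d z⟨ n ⟩ l ≼ q ^ n
      lim = FL.limit 0≤q q<1 z⟨_⟩ z-close

    ψ-fun : ∣L∣ → ∣ F₀ F L ∣
    ψ-fun x = proj₁ (Embed.lim x)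

    widen : ∀ {X : Space} {x y} n → Space.d X x y ≼ q ^ n → Space.d X x y ≼ q ^ n ℚ.+ q ^ n
    widen {X} {x} {y} n = upper (Space.d X x y)
      (ℚ.≤-trans (ℚ.≤-reflexive (≡.sym (ℚ.+-identityʳ _))) (ℚ.+-monoʳ-≤ (q ^ n) (^-nonneg n)))

    φψ : ∀ x → L._≈_ (fun φ (ψ-fun x)) x
    φψ x = ℚ.≤-refl , λ
      { zero    → ℚ.≤-refl
      ; (suc m) → Chain.≈⇒≼ (suc m) (Chain.≈-squeeze (suc m) 0≤q q<1 λ k →
          widen {chain (suc m)} k (Chain.d-sym (suc m)
            (Chain.d-resp (suc m)
              (Chain.≈-sym (suc m) (Chain.≈-trans (suc m)
                (F-∘ (π-j m k) (proj₁ x (suc m ℕ.+ k))) (proj₂ x (suc m) k)))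
              (Chain.≈-refl (suc m))
              (upper (Chain.d (suc m) _ _) (subst (λ i → q ^ i ℚ.≤ q ^ k) (ℕ.+-comm k m) (^-anti k m))
                (nonexpanding (F₁ F (π m)) _ _ _ (proj₂ lim (m ℕ.+ k))))))) }
      where open Embed x

    jπ-close : ∀ x m y → L.d (fun (Embed.j x m ∘ π m) y) y ≼ q ^ m
    jπ-close x zero    y = L.d≼1 {x} {y}
    jπ-close x (suc m) y = L.d-resp {fun (j (suc m) ∘ π (suc m)) y} {fun (φ ∘ F₁ F (j m ∘ π m)) (ψ-fun y)} {y} {fun φ (ψ-fun y)}
        (L.≈-trans {fun (j (suc m) ∘ π (suc m)) y} {fun (j (suc m) ∘ F₁ F (π m)) (ψ-fun y)} {fun (φ ∘ F₁ F (j m ∘ π m)) (ψ-fun y)}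
          (fun-cong (j (suc m)) (Chain.≈-sym (suc m) (Chain.≼⇒≈ (suc m) (proj₂ (φψ y) (suc m)))))
          (fun-cong φ (F-∘ {h = j m ∘ π m} (pointwise λ z → L.≈-refl {fun (j m ∘ π m) z}) (ψ-fun y))))
        (L.≈-sym {fun φ (ψ-fun y)} {y} (φψ y))
        (nonexpanding φ _ _ _
          (FL.d-resp FL.≈-refl (FL.≈-sym (pt identity (ψ-fun y)))
            (contract (j m ∘ π m) id (^-nonneg m) (jπ-close x m) (ψ-fun y))))
      where open Embed x

    φ-isometry : ∀ {u v p} → L.d (fun φ u) (fun φ v) ≼ p → FL.d u v ≼ p
    φ-isometry {u} {v} {p} (_ , h) = FL.squeeze 0≤q q<1 λ m →
        bound3 (F₀ F L) (FL.d-sym (near m u))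
          (FL.d-resp (back m u) (back m v) (nonexpanding (F₁ F (j m)) _ _ p (h (suc m))))
          (near m v)
      where
      open Embed (fun φ u)
      near : ∀ m w → FL.d (fun (F₁ F (j m ∘ π m)) w) w ≼ q ^ m
      near m w = upper (FL.d (fun (F₁ F (j m ∘ π m)) w) w) (^-suc m)
        (FL.d-resp FL.≈-refl (FL.≈-sym (pt identity w))
          (contract (j m ∘ π m) id (^-nonneg m) (jπ-close (fun φ u) m) w))
      back : ∀ m w → FL._≈_ (fun (F₁ F (j m ∘ π m)) w) (fun (F₁ F (j m)) (fun (F₁ F (π m)) w))
      back m w = FL.≈-sym (F-∘ (pointwise λ z → L.≈-refl {fun (j m ∘ π m) z}) w)

    ψ : L ⇒ F₀ F L
    ψ = record
      { fun          = ψ-fun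
      ; nonexpanding = λ x y p h → φ-isometry
          (L.d-resp {fun φ (ψ-fun x)} {x} {fun φ (ψ-fun y)} {y} (φψ x) (φψ y) h)
      }

    module _ {Y : Space} (c : Y ⇒ F₀ F Y) where
      h⟨_⟩ : ∀ n → Y ⇒ chain n
      h⟨ zero ⟩  = !
      h⟨ suc n ⟩ = F₁ F h⟨ n ⟩ ∘ c

      h-thread : ∀ m k → P m k ∘ h⟨ m ℕ.+ k ⟩ ≈ h⟨ m ⟩
      h-thread zero    k = pointwise λ _ → ℚ.≤-refl
      h-thread (suc m) k = pointwise λ y → F-∘ (h-thread m k) (fun c y)

      unfold : Y ⇒ L
      unfold = record
        { fun          = λ y → (λ n → fun h⟨ n ⟩ y) , λ m k → pt (h-thread m k) y
        ; nonexpanding = λ x y p h → nonneg (Space.d Y x y) h , λ n → nonexpanding h⟨ n ⟩ x y p h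
        }

      unfold-hom : ψ ∘ unfold ≈ F₁ F unfold ∘ c
      unfold-hom = pointwise λ y → FL.≼⇒≈ (φ-isometry
        (L.d-resp {fun φ (ψ-fun (fun unfold y))} {fun unfold y}
                  {fun φ (fun (F₁ F unfold) (fun c y))} {fun φ (fun (F₁ F unfold) (fun c y))}
          (φψ (fun unfold y)) (L.≈-refl {fun φ (fun (F₁ F unfold) (fun c y))})
          (ℚ.≤-refl , λ
            { zero    → ℚ.≤-refl
            ; (suc m) → Chain.≈⇒≼ (suc m) (Chain.≈-sym (suc m)
                (F-∘ (pointwise λ _ → Chain.≈-refl m) (fun c y))) })))

      module _ {g : Y ⇒ L} (g-hom : ψ ∘ g ≈ F₁ F g ∘ c) where
        π-g : ∀ n y → Chain._≈_ n (fun (π n) (fun g y)) (fun h⟨ n ⟩ y)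
        π-g zero    y = ℚ.≤-refl
        π-g (suc m) y = Chain.≈-trans (suc m) {fun (π (suc m)) (fun g y)} {fun (F₁ F (π m)) (ψ-fun (fun g y))} {fun h⟨ suc m ⟩ y}
          (Chain.≈-sym (suc m) (Chain.≼⇒≈ (suc m) (proj₂ (φψ (fun g y)) (suc m))))
          (Chain.≈-trans (suc m) {fun (F₁ F (π m)) (ψ-fun (fun g y))} {fun (F₁ F (π m)) (fun (F₁ F g) (fun c y))} {fun h⟨ suc m ⟩ y}
            (fun-cong (F₁ F (π m)) (pt g-hom y))
            (F-∘ {f = g} {g = π m} {h = h⟨ m ⟩} (pointwise (π-g m)) (fun c y)))

        unfold-unique : unfold ≈ g
        unfold-unique = pointwise λ y → ℚ.≤-refl , λ n →
          Chain.≈⇒≼ n {fun h⟨ n ⟩ y} {fun (π n) (fun g y)} (Chain.≈-sym n (π-g n y))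

  finalCoalgebra : FinalCoalgebra F
  finalCoalgebra = record
    { carrier   = L
    ; structure = ψ
    ; final     = λ c → unfold c , unfold-hom c , λ {g} → unfold-unique c {g}
    }

-- Hence an element of Iteratable (H ⊕ V) is merely a choice of final coalgebras, which
-- always exist and are unique up to isomorphism.
contracting⇒iteratable : Contracting F → Iteratable F
contracting⇒iteratable cF X = Final.finalCoalgebra (⊕-contracting cF (const-contracting X))

module ContractingSchemes {H V : Endofunctor} (cH : Contracting H) (cV : Contracting V)
                          (T : Iteratable (H ⊕ V)) where
  open Free (H ⊕ V) T public
  open Schemes H V T public

  -- For contracting functors guardedness of e is not needed here.
  monadExtension : (e : RecursiveProgramScheme) →
    ∃! _≈ᵐ_ λ m → ∀ X → transformation m at X ∘ κ X ≈ [ κ X ∘ inl , e at X ]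
  monadExtension e = Extend.monadExtension (Banach.solution (⊕-contracting cH cV)) [κinl, e ]

  ê : RecursiveProgramScheme → NatTrans TF TF
  ê e = transformation (proj₁ (monadExtension e))

  IsInterpretedSolution : RecursiveProgramScheme → ∀ {A} → F₀ H A ⇒ A → F₀ V A ⇒ A → Set₁
  IsInterpretedSolution e {A} a e‡ =
    Σ (CompleteElgot (H ⊕ V) [ a , e‡ ]) λ E →
      let open CompleteElgot E using (_*) in α A * ∘ ê e at A ≈ α A *

  -- the evaluation morphism of the cia [ a , f ]
  evaluation : ∀ {A} → F₀ H A ⇒ A → ∣ A ∣ → F₀ V A ⇒ A → T₀ A ⇒ A
  evaluation {A} a a₀ f = proj₁ (cia (⊕-contracting cH cV) [ a , f ] a₀ (α A))

  R : RecursiveProgramScheme → ∀ {A} → F₀ H A ⇒ A → ∣ A ∣ → F₀ V A ⇒ A → F₀ V A ⇒ A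
  R e {A} a a₀ f = evaluation a a₀ f ∘ e at A

-- x is the unique morphism satisfying P
IsTheUnique : ∀ {p} → (X ⇒ Y → Set p) → X ⇒ Y → Set p
IsTheUnique P x = P x × (∀ {y} → P y → x ≈ y)

module Submission where

-- Banach's theorem does not apply directly to R: if H and V are contracting by q, the obvious
-- estimate of its Lipschitz constant is only q/(1-q).  The fixed points of R are instead
-- obtained from their evaluations.  Write e = τ · inl · g.  If
-- f = R f, then the evaluation s of [a,f] satisfies
--   s · τ = a · H s · [ id , H μ · g T ],   s · η = id,
-- an equation that no longer mentions f and is a flat equation for H alone, hence has a
-- unique solution s in the cia (A,a); and f = s · e.  Conversely the solution s satisfies
-- s · μ = s · T s, as both sides solve the same flat equation, and this makes s the
-- evaluation of [a, s · e].  Finally, the evaluation t of [a,f] satisfies t · ê = t if and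
-- only if t · e = f, because t · ê solves the same equation as t as soon as t · e = f.

open import Defs using (Category; Coproducts; module Iteration)
open import Data.Product using (Σ; ∃-syntax; ∃!; _×_; _,_; proj₁; proj₂)
open import Level using (_⊔_)

module CompletelyIterative {o ℓ ε} (C : Category o ℓ ε) (P : Coproducts C) where
  open Category C
  open Coproducts P
  open Iteration C P
  open MorphismReasoning

  private variable
    A B X Y Z W : Obj

  -- Calculus of coproducts.

  []∘+₁ : {f : X ⇒ Z} {g : Y ⇒ Z} {h : A ⇒ X} {k : B ⇒ Y} → [ f , g ] ∘ (h +₁ k) ≈ [ f ∘ h , g ∘ k ]
  []∘+₁ = ≈-sym ∘-[] ∙ []-cong (pullˡ inject₁) (pullˡ inject₂)

  +₁-cong : {f f′ : A ⇒ X} {g g′ : B ⇒ Y} → f ≈ f′ → g ≈ g′ → f +₁ g ≈ f′ +₁ g′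
  +₁-cong p q = []-cong (∘-congʳ p) (∘-congʳ q)

  +₁-∘ : {f : X ⇒ Z} {g : Y ⇒ W} {h : A ⇒ X} {k : B ⇒ Y} → (f +₁ g) ∘ (h +₁ k) ≈ f ∘ h +₁ g ∘ k
  +₁-∘ = []∘+₁ ∙ []-cong assoc assoc

  -- Completely iterative algebras are complete Elgot algebras.

  module _ {F : Endofunctor} {A : Obj} {a : F₀ F A ⇒ A} (cia : CIA F a) where
    open Endofunctor F using (homomorphism)

    private
      infix 10 _†
      _† : X ⇒ F₀ F X ⨿ A → X ⇒ A
      d † = proj₁ (cia d)

      †-solution : (d : X ⇒ F₀ F X ⨿ A) → d † ≈ [ a ∘ F₁ F (d †) , id ] ∘ d
      †-solution d = proj₁ (proj₂ (cia d)) ∙ pullˡ ([]∘+₁ ∙ []-cong ≈-refl identityˡ)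

      †-functorial : (d : X ⇒ F₀ F X ⨿ A) (f : Y ⇒ F₀ F Y ⨿ A) (h : X ⇒ Y) →
        f ∘ h ≈ (F₁ F h +₁ id) ∘ d → d † ≈ f † ∘ h
      †-functorial d f h p = proj₂ (proj₂ (cia d)) (begin
        f † ∘ h                                                ≈⟨ pushˡ (proj₁ (proj₂ (cia f))) ∙ ∘-congʳ assoc ⟩
        [ a , id ] ∘ (F₁ F (f †) +₁ id) ∘ f ∘ h                ≈⟨ ∘-congʳ (∘-congʳ p) ⟩
        [ a , id ] ∘ (F₁ F (f †) +₁ id) ∘ (F₁ F h +₁ id) ∘ d
          ≈⟨ ∘-congʳ (pullˡ (+₁-∘ ∙ +₁-cong (≈-sym homomorphism) identityˡ)) ⟩
        [ a , id ] ∘ (F₁ F (f † ∘ h) +₁ id) ∘ d                ∎)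

      module Compositionality (d : X ⇒ F₀ F X ⨿ Y) (f : Y ⇒ F₀ F Y ⨿ A) where
        g : X ⨿ Y ⇒ F₀ F (X ⨿ Y) ⨿ A
        g = ([ F₁ F inl , F₁ F inr ] +₁ id) ∘ assocˡ ∘ (id +₁ f) ∘ [ d , inr ]

        -- Needed so that functoriality along `inr` identifies `f †` with a restriction of `g †`.
        g-inr : g ∘ inr ≈ (F₁ F inr +₁ id) ∘ f
        g-inr = begin
          g ∘ inr
            ≈⟨ assoc ∙ ∘-congʳ (assoc ∙ ∘-congʳ (assoc ∙ ∘-congʳ inject₂ ∙ inject₂)) ⟩
          ([ F₁ F inl , F₁ F inr ] +₁ id) ∘ assocˡ ∘ inr ∘ f
            ≈⟨ ∘-congʳ (pullˡ inject₂) ⟩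
          ([ F₁ F inl , F₁ F inr ] +₁ id) ∘ [ inl ∘ inr , inr ] ∘ f
            ≈⟨ pullˡ (≈-sym ∘-[]) ⟩
          [ ([ F₁ F inl , F₁ F inr ] +₁ id) ∘ inl ∘ inr , ([ F₁ F inl , F₁ F inr ] +₁ id) ∘ inr ] ∘ f
            ≈⟨ ∘-congˡ ([]-cong (pullˡ inject₁ ∙ assoc ∙ ∘-congʳ inject₂) inject₂) ⟩
          (F₁ F inr +₁ id) ∘ f ∎

        f†≈ : f † ≈ g † ∘ inr
        f†≈ = †-functorial f g inr g-inr

        a∘F : {h : Z ⇒ X ⨿ Y} → (a ∘ F₁ F (g †)) ∘ F₁ F h ≈ a ∘ F₁ F (g † ∘ h)
        a∘F = assoc ∙ ∘-congʳ (≈-sym homomorphism)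

        -- The inner bracket on the right is one side of the fixed-point equation of `f †`, so
        -- precomposing with `id +₁ f` collapses it to `f †`.
        regroup : [ a ∘ F₁ F (g †) , id ] ∘ ([ F₁ F inl , F₁ F inr ] +₁ id) ∘ assocˡ
                    ≈ [ a ∘ F₁ F (g † ∘ inl) , [ a ∘ F₁ F (f †) , id ] ]
        regroup = begin
          [ a ∘ F₁ F (g †) , id ] ∘ ([ F₁ F inl , F₁ F inr ] +₁ id) ∘ assocˡ
            ≈⟨ pullˡ ([]∘+₁ ∙ []-cong (≈-sym ∘-[] ∙ []-cong a∘F
                 (a∘F ∙ ∘-congʳ (Endofunctor.F-resp-≈ F (≈-sym f†≈)))) identityˡ) ⟩
          [ [ a ∘ F₁ F (g † ∘ inl) , a ∘ F₁ F (f †) ] , id ] ∘ assocˡ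
            ≈⟨ ≈-sym ∘-[] ∙ []-cong (pullˡ inject₁ ∙ inject₁)
                 (≈-sym ∘-[] ∙ []-cong (pullˡ inject₁ ∙ inject₂) inject₂) ⟩
          [ a ∘ F₁ F (g † ∘ inl) , [ a ∘ F₁ F (f †) , id ] ] ∎

        proof : ((id +₁ f †) ∘ d) † ≈ g † ∘ inl
        proof = proj₂ (proj₂ (cia ((id +₁ f †) ∘ d))) (begin
          g † ∘ inl
            ≈⟨ pushˡ (†-solution g) ⟩
          [ a ∘ F₁ F (g †) , id ] ∘ g ∘ inl
            ≈⟨ ∘-congʳ (assoc ∙ ∘-congʳ (assoc ∙ ∘-congʳ (assoc ∙ ∘-congʳ inject₁)))
                 ∙ ∘-congʳ (≈-sym assoc) ∙ pullˡ regroup ⟩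
          [ a ∘ F₁ F (g † ∘ inl) , [ a ∘ F₁ F (f †) , id ] ] ∘ (id +₁ f) ∘ d
            ≈⟨ pullˡ ([]∘+₁ ∙ []-cong identityʳ (≈-sym (†-solution f))) ⟩
          [ a ∘ F₁ F (g † ∘ inl) , f † ] ∘ d
            ≈⟨ pushˡ (≈-sym ([]∘+₁ ∙ []-cong identityʳ identityˡ)) ⟩
          [ a ∘ F₁ F (g † ∘ inl) , id ] ∘ (id +₁ f †) ∘ d
            ≈⟨ pushˡ (≈-sym ([]∘+₁ ∙ []-cong ≈-refl identityˡ)) ⟩
          [ a , id ] ∘ (F₁ F (g † ∘ inl) +₁ id) ∘ (id +₁ f †) ∘ d ∎)

    cia⇒elgot : CompleteElgot F a
    cia⇒elgot = record
      { _*               = _†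
      ; solution         = λ d → proj₁ (proj₂ (cia d))
      ; functoriality    = †-functorial
      ; compositionality = Compositionality.proof
      }

  -- Recursion on `T₀` with values in a cia.

  module Recursion {F : Endofunctor} (T : Iteratable F) {G : Endofunctor}
                   (ρ : ∀ X → F₀ F (Free.T₀ F T X) ⇒ F₀ G (Free.T₀ F T X))
                   {A : Obj} {a : F₀ G A ⇒ A} (cia : CIA G a) where
    open Free F T
    open Endofunctor using (homomorphism)

    -- `ρ` trades a layer of `F` for one of `G`. With `G = F` and `ρ` the identity this describes
    -- evaluation morphisms; with `H ⊕ V` for `F` and `H` for `G` it gives the equation that no
    -- longer mentions `f`.
    IsRecursive : X ⇒ A → T₀ X ⇒ A → Set ε
    IsRecursive {X} k s = s ∘ τ X ≈ a ∘ F₁ G s ∘ ρ X × s ∘ η X ≈ k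

    -- As `α X` is invertible, such morphisms are exactly the solutions of a flat equation for `G`
    -- with `T₀ X` as object of variables.
    recursion : (k : X ⇒ A) → ∃! _≈_ (IsRecursive k)
    recursion {X} k = s , fromα (s-solution ∙ rhs) , λ (p , q) → s-unique ([τ,η]∘α p q ∙ ≈-sym rhs)
      where
      d : T₀ X ⇒ F₀ G (T₀ X) ⨿ A
      d = (ρ X +₁ k) ∘ α X
      s = proj₁ (cia d)
      s-solution = proj₁ (proj₂ (cia d))
      s-unique = proj₂ (proj₂ (cia d))
      rhs : {s : T₀ X ⇒ A} → [ a , id ] ∘ (F₁ G s +₁ id) ∘ d ≈ [ a ∘ F₁ G s ∘ ρ X , k ] ∘ α X
      rhs = ∘-congʳ (pullˡ +₁-∘) ∙ pullˡ ([]∘+₁ ∙ []-cong ≈-refl (identityˡ ∙ identityˡ))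

    recursion-unique : {k : X ⇒ A} {s t : T₀ X ⇒ A} → IsRecursive k s → IsRecursive k t → s ≈ t
    recursion-unique {k = k} p q =
      ≈-sym (proj₂ (proj₂ (recursion k)) p) ∙ proj₂ (proj₂ (recursion k)) q

    -- Both sides are the recursive extension of s itself.
    recursion-μ :
      (∀ {X Y} (f : X ⇒ Y) → ρ Y ∘ F₁ F (T₁ f) ≈ F₁ G (T₁ f) ∘ ρ X) →
      (∀ X → ρ X ∘ F₁ F (μ X) ≈ F₁ G (μ X) ∘ ρ (T₀ X)) →
      {s : T₀ A ⇒ A} → IsRecursive id s → s ∘ μ A ≈ s ∘ T₁ s
    recursion-μ ρ-T₁ ρ-μ {s} (s-τ , s-η) = recursion-unique
      (along extend-τ (ρ-μ A) , assoc ∙ ∘-congʳ μη ∙ identityʳ)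
      (along extend-τ (ρ-T₁ s) , assoc ∙ ∘-congʳ T₁η ∙ pullˡ s-η ∙ identityˡ)
      where
      along : {h : T₀ (T₀ A) ⇒ T₀ A} → h ∘ τ (T₀ A) ≈ τ A ∘ F₁ F h → ρ A ∘ F₁ F h ≈ F₁ G h ∘ ρ (T₀ A) →
              (s ∘ h) ∘ τ (T₀ A) ≈ a ∘ F₁ G (s ∘ h) ∘ ρ (T₀ A)
      along {h} h-τ h-ρ = begin
        (s ∘ h) ∘ τ (T₀ A)                ≈⟨ assoc ∙ ∘-congʳ h-τ ⟩
        s ∘ τ A ∘ F₁ F h                  ≈⟨ pullˡ s-τ ∙ assoc ∙ ∘-congʳ assoc ⟩
        a ∘ F₁ G s ∘ ρ A ∘ F₁ F h         ≈⟨ ∘-congʳ (∘-congʳ h-ρ) ⟩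
        a ∘ F₁ G s ∘ F₁ G h ∘ ρ (T₀ A)    ≈⟨ ∘-congʳ (pullˡ (≈-sym (homomorphism G))) ⟩
        a ∘ F₁ G (s ∘ h) ∘ ρ (T₀ A)       ∎

  -- Evaluation morphisms of a cia.

  module Evaluation {F : Endofunctor} (T : Iteratable F) {A : Obj} {b : F₀ F A ⇒ A} (cia : CIA F b) where
    open Free F T
    open Endofunctor F using (identity; homomorphism; F-resp-≈)
    open Recursion T {G = F} (λ _ → id) cia

    IsEvaluation : T₀ A ⇒ A → Set ε
    IsEvaluation s = s ∘ τ A ≈ b ∘ F₁ F s × s ∘ η A ≈ id

    private
      recursive : {s : T₀ A ⇒ A} → IsEvaluation s → IsRecursive id s
      recursive (p , q) = p ∙ ∘-congʳ (≈-sym identityʳ) , q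

    solution⇒evaluation : {s : T₀ A ⇒ A} → IsSolution F b (α A) s → IsEvaluation s
    solution⇒evaluation p = fromα (p ∙ pullˡ ([]∘+₁ ∙ []-cong ≈-refl identityˡ))

    evaluation-unique : {s t : T₀ A ⇒ A} → IsEvaluation s → IsEvaluation t → s ≈ t
    evaluation-unique p q = recursion-unique (recursive p) (recursive q)

    -- The associativity law of an Eilenberg-Moore algebra; with `ρ` the identity both compatibility
    -- conditions are trivial.
    evaluation-μ : {s : T₀ A ⇒ A} → IsEvaluation s → s ∘ μ A ≈ s ∘ T₁ s
    evaluation-μ p = recursion-μ (λ _ → identityˡ ∙ ≈-sym identityʳ) (λ _ → identityˡ ∙ ≈-sym identityʳ)
      (recursive p)

    evaluation-κ : {s : T₀ A ⇒ A} → IsEvaluation s → s ∘ κ A ≈ b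
    evaluation-κ (p , q) = pullˡ p ∙ assoc
      ∙ ∘-congʳ (≈-sym homomorphism ∙ F-resp-≈ q ∙ identity) ∙ identityʳ

  module SchemeSolutions (H V : Endofunctor) (T : Iteratable (H ⊕ V)) where
    open Free (H ⊕ V) T
    open Schemes H V T
    open Endofunctor using (homomorphism; F-resp-≈)
    open NatTrans using (natural)

    private
      F : Endofunctor
      F = H ⊕ V

    -- Fixed points of `R` and invariance under `ê`.

    module _ (e : RecursiveProgramScheme) {A : Obj} {a : F₀ H A ⇒ A} {f : F₀ V A ⇒ A} (cia : CIA F [ a , f ])
             (m : MonadMorphism) (m-κ : ∀ X → transformation m at X ∘ κ X ≈ [ κ X ∘ inl , e at X ]) where
      open Evaluation T cia

      private
        ê : ∀ X → T₀ X ⇒ T₀ X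
        ê X = transformation m at X

        σ : ∀ X → F₀ F X ⇒ T₀ X
        σ X = [ κ X ∘ inl , e at X ]

        -- Writing `τ` as `μ ∘ κ` turns multiplicativity into a recursive equation governed by the
        -- restriction of `ê` along `κ`.
        m-τ : ê A ∘ τ A ≈ μ A ∘ σ (T₀ A) ∘ F₁ F (ê A)
        m-τ = begin
          ê A ∘ τ A                                ≈⟨ ∘-congʳ (≈-sym μκ) ⟩
          ê A ∘ μ A ∘ κ (T₀ A)                     ≈⟨ pullˡ (MonadMorphism.multiplication m A) ⟩
          (μ A ∘ T₁ (ê A) ∘ ê (T₀ A)) ∘ κ (T₀ A)   ≈⟨ assoc ∙ ∘-congʳ (assoc ∙ ∘-congʳ (m-κ (T₀ A))) ⟩
          μ A ∘ T₁ (ê A) ∘ σ (T₀ A)                ≈⟨ ∘-congʳ (≈-sym (natural [κinl, e ] (ê A))) ⟩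
          μ A ∘ σ (T₀ A) ∘ F₁ F (ê A)              ∎

      -- Restrict the invariance along `κ A ∘ inr`, where `ê A` becomes `e at A` and `t` becomes
      -- `f`.
      interpreted⇒fixed : {t : T₀ A ⇒ A} → IsEvaluation t → t ∘ ê A ≈ t → t ∘ e at A ≈ f
      interpreted⇒fixed {t} t-ev p = begin
        t ∘ e at A               ≈⟨ ∘-congʳ (≈-sym inject₂ ∙ ∘-congˡ (≈-sym (m-κ A))) ⟩
        t ∘ (ê A ∘ κ A) ∘ inr   ≈⟨ ∘-congʳ assoc ∙ pullˡ p ⟩
        t ∘ κ A ∘ inr            ≈⟨ pullˡ (evaluation-κ t-ev) ⟩
        [ a , f ] ∘ inr          ≈⟨ inject₂ ⟩
        f                        ∎

      fixed⇒interpreted : {t : T₀ A ⇒ A} → IsEvaluation t → t ∘ e at A ≈ f → t ∘ ê A ≈ t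
      fixed⇒interpreted {t} t-ev p = evaluation-unique
        ((begin
            (t ∘ ê A) ∘ τ A                    ≈⟨ assoc ∙ ∘-congʳ m-τ ⟩
            t ∘ μ A ∘ σ (T₀ A) ∘ F₁ F (ê A)    ≈⟨ extendʳ (evaluation-μ t-ev) ⟩
            t ∘ T₁ t ∘ σ (T₀ A) ∘ F₁ F (ê A)   ≈⟨ ∘-congʳ (extendʳ (≈-sym (natural [κinl, e ] t))) ⟩
            t ∘ σ A ∘ F₁ F t ∘ F₁ F (ê A)
              -- The hypothesis `p` enters here: it makes `t ∘ σ A` equal to `[ a , f ]`.
              ≈⟨ pullˡ (≈-sym ∘-[] ∙ []-cong (pullˡ (evaluation-κ t-ev) ∙ inject₁) p) ⟩
            [ a , f ] ∘ F₁ F t ∘ F₁ F (ê A)    ≈⟨ ∘-congʳ (≈-sym (homomorphism F)) ⟩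
            [ a , f ] ∘ F₁ F (t ∘ ê A)         ∎)
        , assoc ∙ ∘-congʳ (MonadMorphism.unit m A) ∙ proj₂ t-ev)
        t-ev

    -- The fixed point by recursion in the cia for `H`.

    module GuardedScheme (e : RecursiveProgramScheme) (guarded : Guarded e)
                         {A : Obj} {a : F₀ H A ⇒ A} (cia : CIA H a) where
      private
        g : NatTrans V (H ∘F TF)
        g = proj₁ guarded

        -- A layer of `V` is unfolded once by the guarded body `g`, exposing a layer of `H`; `μ`
        -- flattens the nested trees below it.
        ρ : ∀ X → F₀ F (T₀ X) ⇒ F₀ H (T₀ X)
        ρ X = [ id , F₁ H (μ X) ∘ g at T₀ X ]

        -- The hypothesis makes `h` a homomorphism of free Eilenberg-Moore algebras, which covers
        -- both `T₁ f` and `μ`.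
        ρ-natural : {h : T₀ X ⇒ T₀ Y} → μ Y ∘ T₁ h ≈ h ∘ μ X → ρ Y ∘ F₁ F h ≈ F₁ H h ∘ ρ X
        ρ-natural {X} {Y} {h} p = []∘+₁ ∙ []-cong (identityˡ ∙ ≈-sym identityʳ) (begin
          (F₁ H (μ Y) ∘ g at T₀ Y) ∘ F₁ V h         ≈⟨ assoc ∙ ∘-congʳ (natural g h) ⟩
          F₁ H (μ Y) ∘ F₁ H (T₁ h) ∘ g at T₀ X
            ≈⟨ pullˡ (≈-sym (homomorphism H) ∙ F-resp-≈ H p ∙ homomorphism H) ∙ assoc ⟩
          F₁ H h ∘ F₁ H (μ X) ∘ g at T₀ X           ∎) ∙ ∘-[]

        -- Guardedness exposes a layer of `H`, on which `t` acts through `a`. Applied both to `s`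
        -- and to evaluations of `[ a , f ]`.
        e-step : {t : T₀ A ⇒ A} → t ∘ τ A ∘ inl ≈ a ∘ F₁ H t → t ∘ μ A ≈ t ∘ T₁ t →
              (t ∘ e at A) ∘ F₁ V t ≈ a ∘ F₁ H t ∘ F₁ H (μ A) ∘ g at T₀ A
        e-step {t} t-inl t-μ = begin
          (t ∘ e at A) ∘ F₁ V t                            ≈⟨ assoc ∙ ∘-congʳ (natural e t) ⟩
          t ∘ T₁ t ∘ e at T₀ A                             ≈⟨ extendʳ (≈-sym t-μ) ⟩
          t ∘ μ A ∘ e at T₀ A                              ≈⟨ ∘-congʳ (∘-congʳ (proj₂ guarded (T₀ A))) ⟩
          t ∘ μ A ∘ τ (T₀ A) ∘ inl ∘ g at T₀ A             ≈⟨ ∘-congʳ (extendʳ extend-τ) ⟩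
          t ∘ τ A ∘ F₁ F (μ A) ∘ inl ∘ g at T₀ A           ≈⟨ ∘-congʳ (∘-congʳ (pullˡ inject₁ ∙ assoc)) ⟩
          t ∘ τ A ∘ inl ∘ F₁ H (μ A) ∘ g at T₀ A           ≈⟨ ∘-congʳ (≈-sym assoc) ∙ pullˡ t-inl ∙ assoc ⟩
          a ∘ F₁ H t ∘ F₁ H (μ A) ∘ g at T₀ A              ∎

        open Recursion T {G = H} ρ cia

        s : T₀ A ⇒ A
        s = proj₁ (recursion id)

        s-recursive : IsRecursive id s
        s-recursive = proj₁ (proj₂ (recursion id))

        s-inl : s ∘ τ A ∘ inl ≈ a ∘ F₁ H s
        s-inl = pullˡ (proj₁ s-recursive) ∙ assoc ∙ ∘-congʳ (assoc ∙ ∘-congʳ inject₁ ∙ identityʳ)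

      fixedPoint : F₀ V A ⇒ A
      fixedPoint = s ∘ e at A

      module _ {f : F₀ V A ⇒ A} (cia′ : CIA F [ a , f ]) where
        open Evaluation T cia′

        private
          evaluation-inl : {t : T₀ A ⇒ A} → IsEvaluation t → t ∘ τ A ∘ inl ≈ a ∘ F₁ H t
          evaluation-inl (p , _) = pullˡ p ∙ assoc ∙ ∘-congʳ inject₁ ∙ pullˡ inject₁

        fixedPoint-fixed : f ≈ fixedPoint → {t : T₀ A ⇒ A} → IsEvaluation t → t ∘ e at A ≈ f
        fixedPoint-fixed f≈ t-ev = ∘-congˡ (evaluation-unique t-ev s-evaluation) ∙ ≈-sym f≈
          where
          s-μ : s ∘ μ A ≈ s ∘ T₁ s
          s-μ = recursion-μ (λ _ → ρ-natural μ-natural) (λ _ → ρ-natural (≈-sym μ-assoc)) s-recursive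

          s-evaluation : IsEvaluation s
          s-evaluation = (begin
              s ∘ τ A                                                   ≈⟨ proj₁ s-recursive ⟩
              a ∘ F₁ H s ∘ ρ A                                          ≈⟨ ∘-congʳ (≈-sym ∘-[]) ∙ ≈-sym ∘-[] ⟩
              [ a ∘ F₁ H s ∘ id , a ∘ F₁ H s ∘ F₁ H (μ A) ∘ g at T₀ A ]
                -- `e-step` read backwards folds the summand for `V` into `fixedPoint ∘ F₁ V s`.
                ≈⟨ []-cong (∘-congʳ identityʳ) (≈-sym (e-step s-inl s-μ) ∙ ∘-congˡ (≈-sym f≈)) ⟩
              [ a ∘ F₁ H s , f ∘ F₁ V s ]                               ≈⟨ ≈-sym []∘+₁ ⟩
              [ a , f ] ∘ F₁ F s                                        ∎)
            , proj₂ s-recursive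

        -- Replacing `f` by `t ∘ e at A` in the evaluation equation shows that `t` satisfies the
        -- recursion defining `s`.
        fixedPoint-unique : {t : T₀ A ⇒ A} → IsEvaluation t → t ∘ e at A ≈ f → fixedPoint ≈ f
        fixedPoint-unique {t} t-ev p = ∘-congˡ (recursion-unique s-recursive t-recursive) ∙ p
          where
          t-recursive : IsRecursive id t
          t-recursive = (begin
              t ∘ τ A                                                   ≈⟨ proj₁ t-ev ∙ []∘+₁ ⟩
              [ a ∘ F₁ H t , f ∘ F₁ V t ]
                ≈⟨ []-cong (∘-congʳ (≈-sym identityʳ))
                     (∘-congˡ (≈-sym p) ∙ e-step (evaluation-inl t-ev) (evaluation-μ t-ev)) ⟩
              [ a ∘ F₁ H t ∘ id , a ∘ F₁ H t ∘ F₁ H (μ A) ∘ g at T₀ A ] ≈⟨ ∘-[] ∙ ∘-congʳ ∘-[] ⟩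
              a ∘ F₁ H t ∘ ρ A                                          ∎)
            , proj₂ t-ev

    -- Interpreted solutions are exactly the fixed points.

    module _ (e : RecursiveProgramScheme) (guarded : Guarded e) {A : Obj} (a : F₀ H A ⇒ A)
             (cia : CIA H a) (ciaF : (f : F₀ V A ⇒ A) → CIA F [ a , f ])
             (m : MonadMorphism) (m-κ : ∀ X → transformation m at X ∘ κ X ≈ [ κ X ∘ inl , e at X ]) where
      open GuardedScheme e guarded cia

      private
        eval : (F₀ V A ⇒ A) → T₀ A ⇒ A
        eval f = proj₁ (ciaF f (α A))

        IsInterpreted : (F₀ V A ⇒ A) → Set (o ⊔ ℓ ⊔ ε)
        IsInterpreted f = Σ (CompleteElgot F [ a , f ]) λ E →
          let open CompleteElgot E using (_*) in α A * ∘ transformation m at A ≈ α A *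

        IsFixed : (F₀ V A ⇒ A) → Set ε
        IsFixed f = eval f ∘ e at A ≈ f

        isEvaluation : (f : F₀ V A ⇒ A) → Evaluation.IsEvaluation T (ciaF f) (eval f)
        isEvaluation f = Evaluation.solution⇒evaluation T (ciaF f) (proj₁ (proj₂ (ciaF f (α A))))

        fixed⇒interpretedSolution : {f : F₀ V A ⇒ A} → IsFixed f → IsInterpreted f
        fixed⇒interpretedSolution {f} p =
          cia⇒elgot (ciaF f) , fixed⇒interpreted e (ciaF f) m m-κ (isEvaluation f) p

        -- Whatever the operation of `E` is, its value at `α A` solves `α A`, hence equals `eval f`.
        interpretedSolution⇒fixed : {f : F₀ V A ⇒ A} → IsInterpreted f → IsFixed f
        interpretedSolution⇒fixed {f} (E , p) =
          ∘-congˡ (proj₂ (proj₂ (ciaF f (α A))) α*-solution)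
            ∙ interpreted⇒fixed e (ciaF f) m m-κ (Evaluation.solution⇒evaluation T (ciaF f) α*-solution) p
          where α*-solution = CompleteElgot.solution E (α A)

        fixed : IsFixed fixedPoint
        fixed = fixedPoint-fixed (ciaF fixedPoint) ≈-refl (isEvaluation fixedPoint)

        fixed-unique : {f : F₀ V A ⇒ A} → IsFixed f → fixedPoint ≈ f
        fixed-unique {f} = fixedPoint-unique (ciaF f) (isEvaluation f)

      interpretedSolution-fixedPoint :
        ∃[ e‡ ] (IsInterpreted e‡ × (∀ {f} → IsInterpreted f → e‡ ≈ f))
              × (IsFixed e‡ × (∀ {f} → IsFixed f → e‡ ≈ f))
      interpretedSolution-fixedPoint = fixedPoint
        , (fixed⇒interpretedSolution fixed , λ p → fixed-unique (interpretedSolution⇒fixed p))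
        , fixed , fixed-unique

-- Contracting endofunctors of complete metric spaces.

open import Defs

theorem7p15 : (H V : Endofunctor) (cH : Contracting H) (cV : Contracting V) (T : Iteratable (H ⊕ V)) →
    let open ContractingSchemes cH cV T in
    (e : RecursiveProgramScheme) → Guarded e →
    (A : Space) (a : F₀ H A ⇒ A) (a₀ : ∣ A ∣) →
    ∃[ e‡ ] IsTheUnique (IsInterpretedSolution e a) e‡
    × IsTheUnique (λ f → R e a a₀ f ≈ f) e‡
theorem7p15 H V cH cV T e guarded A a a₀ =
  CompletelyIterative.SchemeSolutions.interpretedSolution-fixedPoint CMS coproducts H V T e guarded {A} a
    -- Banach's theorem makes these algebras cias; `a₀` provides the constant map from which the
    -- iteration starts.
    (cia cH {A} a a₀) (λ f → cia (⊕-contracting cH cV) {A} [ a , f ] a₀)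
    (proj₁ (ContractingSchemes.monadExtension cH cV T e)) (proj₁ (proj₂ (ContractingSchemes.monadExtension cH cV T e)))
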